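{- Let $W_1$ and $W_2$ be two semi-orthogonal weighing matrices of order $m$. Then the signed graph with adjacency matrix $$\mathcal{A}(W_1,W_2)=\begin{pmatrix} O_m & W_1 & W_2\\ W_1^t & O_m & \frac12 W_1^tW_2\\ W_2^t & \frac12 W_2^tW_1 & O_m\end{pmatrix}$$ has spectrum $[4^m,(-2)^{2m}]$, i.e. its eigenvalues are $4$ with multiplicity $m$ and $-2$ with multiplicity $2m$.
   Context: A signed graph is a finite simple graph together with a sign function $\sigma$ on its edges with values in $\{1,-1\}$. Its adjacency matrix has $(i,j)$ entry $\sigma(v_iv_j)$ if $v_i,v_j$ are adjacent and $0$ otherwise; its spectrum is the spectrum of this matrix. A weighing matrix of order $m$ and weight $\alpha$ (a positive integer) is an $m\times m$ matrix $C$ with entries in $\{0,1,-1\}$ such that $CC^t=C^tC=\alpha I_m$. Two weighing matrices $W_1,W_2$ of order $m$, both of weight $4$, are called semi-orthogonal if every entry of $W_1^tW_2$ lies in $\{0,2,-2\}$. $O_m$ is the $m\times m$ zero matrix. -}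

module Defs where

open import Algebra.Bundles.Raw using (RawRing)
open import Data.Bool.Base using (if_then_else_)
open import Data.Fin.Base using (Fin; zero; suc; punchIn)
open import Data.Fin.Properties using (_≟_)
open import Data.Integer.Base using (+_)
open import Data.List.Base as List using (List; []; _∷_)
open import Data.Nat.Base as ℕ using (ℕ; zero; suc)
open import Data.Rational.Base as ℚ using (ℚ; 0ℚ; 1ℚ; ½; _/_; +-*-rawRing)
open import Data.Sign.Base as Sign using (Sign)
open import Data.Sum.Base using (_⊎_)
open import Data.Vec.Functional as Vector using (Vector)
open import Level using (Level; _⊔_)
open import Relation.Binary.Core using (Rel)
open import Relation.Binary.Definitions using (Decidable; Irreflexive; Symmetric)
open import Relation.Binary.PropositionalEquality.Core using (_≡_)
open import Relation.Nullary.Decidable.Core using (does; yes; no)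

private
  variable
    k l m n : ℕ

Matrix : ∀ {a} → Set a → ℕ → ℕ → Set a
Matrix A m n = Vector (Vector A n) m

infixr 6 _∥_
infixr 5 _⫽_

-- Juxtaposition of blocks: _∥_ side by side, _⫽_ one above the other.
_∥_ : ∀ {a} {A : Set a} → Matrix A m k → Matrix A m l → Matrix A m (k ℕ.+ l)
_∥_ = Vector.zipWith Vector._++_

_⫽_ : ∀ {a} {A : Set a} → Matrix A k n → Matrix A l n → Matrix A (k ℕ.+ l) n
_⫽_ = Vector._++_

module MatrixOps {c ℓ : Level} (R : RawRing c ℓ) where

  private module R = RawRing R

  open import Algebra.Definitions.RawMonoid R.+-rawMonoid using (sum)

  infix  4 _≋_
  infixl 7 _·_
  infix  9 _ᵗ

  _≋_ : Matrix R.Carrier m n → Matrix R.Carrier m n → Set ℓ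
  A ≋ B = ∀ i j → A i j R.≈ B i j

  O : ∀ m n → Matrix R.Carrier m n
  O m n i j = R.0#

  I : ∀ n → Matrix R.Carrier n n
  I n i j = if does (i ≟ j) then R.1# else R.0#

  _ᵗ : Matrix R.Carrier m n → Matrix R.Carrier n m
  _ᵗ = Vector.transpose

  _·_ : Matrix R.Carrier m k → Matrix R.Carrier k n → Matrix R.Carrier m n
  (A · B) i j = sum (λ r → A i r R.* B r j)

  infixr 8 _∙_

  _∙_ : R.Carrier → Matrix R.Carrier m n → Matrix R.Carrier m n
  (x ∙ A) i j = x R.* A i j

  [-1]^ : Fin n → R.Carrier
  [-1]^ zero    = R.1#
  [-1]^ (suc j) = R.- [-1]^ j

  -- Laplace expansion along the first row.
  det : Matrix R.Carrier n n → R.Carrier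
  det {zero}  A = R.1#
  det {suc n} A =
    sum (λ j → [-1]^ j R.* (A zero j R.* det (λ r s → A (suc r) (punchIn j s))))

-- Univariate polynomials as coefficient lists, constant term first.  Trailing
-- zeros are allowed, so polynomials are compared coefficient by coefficient.
module Polynomial {c ℓ : Level} (R : RawRing c ℓ) where

  private module R = RawRing R

  Poly : Set c
  Poly = List R.Carrier

  coeff : Poly → ℕ → R.Carrier
  coeff []      k       = R.0#
  coeff (a ∷ p) zero    = a
  coeff (a ∷ p) (suc k) = coeff p k

  _≈ₚ_ : Rel Poly ℓ
  p ≈ₚ q = ∀ k → coeff p k R.≈ coeff q k

  _+ₚ_ : Poly → Poly → Poly
  []      +ₚ q       = q
  (a ∷ p) +ₚ []      = a ∷ p
  (a ∷ p) +ₚ (b ∷ q) = (a R.+ b) ∷ (p +ₚ q)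

  _*ₚ_ : Poly → Poly → Poly
  []      *ₚ q = []
  (a ∷ p) *ₚ q = List.map (a R.*_) q +ₚ (R.0# ∷ (p *ₚ q))

  constant : R.Carrier → Poly
  constant a = a ∷ []

  X : Poly
  X = R.0# ∷ R.1# ∷ []

  polyRawRing : RawRing c ℓ
  polyRawRing = record
    { Carrier = Poly
    ; _≈_     = _≈ₚ_
    ; _+_     = _+ₚ_
    ; _*_     = _*ₚ_
    ; -_      = List.map R.-_
    ; 0#      = []
    ; 1#      = constant R.1#
    }

module Spectrum {c ℓ : Level} (R : RawRing c ℓ) where

  private module R = RawRing R

  open Polynomial R
  open RawRing polyRawRing using (_≈_; _+_; _*_; -_; 1#)
  open MatrixOps polyRawRing using (I; det)

  -- det (X I − A)
  charPoly : Matrix R.Carrier n n → Poly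
  charPoly {n} A = det (λ i j → X * I n i j + - constant (A i j))

  -- The list gives all eigenvalues, each repeated according to its (algebraic)
  -- multiplicity.  As the characteristic polynomial is required to split into
  -- these linear factors, there are no further eigenvalues in any larger field.
  HasSpectrum : Matrix R.Carrier n n → List R.Carrier → Set ℓ
  HasSpectrum A λs = charPoly A ≈ List.foldr (λ λᵢ p → (X + - constant λᵢ) * p) 1# λs

open MatrixOps +-*-rawRing public using (_≋_; O; I; _ᵗ; _·_; _∙_)
open Spectrum +-*-rawRing public using (HasSpectrum)

record SignedGraph (n : ℕ) : Set₁ where
  field
    Adj        : Rel (Fin n) _
    adj?       : Decidable Adj
    adj-sym    : Symmetric Adj
    adj-irrefl : Irreflexive _≡_ Adj
    σ          : ∀ {i j} → Adj i j → Sign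
    -- Edges are unordered; together with adj-sym this also makes σ independent
    -- of the proof of adjacency.
    σ-sym      : ∀ {i j} (e : Adj i j) (e′ : Adj j i) → σ e ≡ σ e′

signValue : Sign → ℚ
signValue Sign.+ = 1ℚ
signValue Sign.- = ℚ.- 1ℚ

adjacencyMatrix : SignedGraph n → Matrix ℚ n n
adjacencyMatrix G i j with SignedGraph.adj? G i j
... | yes e = signValue (SignedGraph.σ G e)
... | no  _ = 0ℚ

record IsWeighing (α : ℕ) (C : Matrix ℚ m m) : Set where
  field
    α-positive : 0 ℕ.< α
    entries    : ∀ i j → C i j ≡ 0ℚ ⊎ C i j ≡ 1ℚ ⊎ C i j ≡ ℚ.- 1ℚ
    CCᵗ≋αI     : C · C ᵗ ≋ (+ α / 1) ∙ I m
    CᵗC≋αI     : C ᵗ · C ≋ (+ α / 1) ∙ I m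

record SemiOrthogonal (W₁ W₂ : Matrix ℚ m m) : Set where
  field
    weighing₁ : IsWeighing 4 W₁
    weighing₂ : IsWeighing 4 W₂
    entries   : ∀ i j → let x = (W₁ ᵗ · W₂) i j in
                x ≡ 0ℚ ⊎ x ≡ + 2 / 1 ⊎ x ≡ ℚ.- (+ 2 / 1)

𝒜 : Matrix ℚ m m → Matrix ℚ m m → Matrix ℚ (m ℕ.+ (m ℕ.+ m)) (m ℕ.+ (m ℕ.+ m))
𝒜 {m} W₁ W₂ =
     (O m m ∥ W₁                ∥ W₂)
  ⫽ (W₁ ᵗ  ∥ O m m             ∥ ½ ∙ (W₁ ᵗ · W₂))
  ⫽ (W₂ ᵗ  ∥ ½ ∙ (W₂ ᵗ · W₁)   ∥ O m m)

{-# OPTIONS --safe #-}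
-- Weighing and semi-orthogonality make A = 𝒜 W₁ W₂ satisfy A² = 2 A + 8 I.
-- For a block matrix A = [O B; C D] with B C = γ I and B D = β B, so that the first block row of A² is
-- β times that of A plus γ times that of I, block row elimination on X I − A gives
--   (X − β)ᵐ det (X I − A) = (X (X − β) − γ)ᵐ det (X I − D).
-- For 𝒜 W₁ W₂ (β = 2, γ = 8) and then for its lower right corner [O ½W₁ᵗW₂; ½W₂ᵗW₁ O] (β = 0, γ = 4) this
-- leaves det (X I − O) = Xᵐ, and the factors (X − 2)ᵐ and Xᵐ cancel.
module Submission where

open import Algebra.Bundles using (AbelianGroup; CommutativeRing)
import Algebra.Construct.Pointwise as Pointwise
import Algebra.Morphism.GroupMonomorphism as GroupMonomorphism
import Algebra.Morphism.RingMonomorphism as RingMonomorphism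
open import Algebra.Morphism.Structures using (IsRingHomomorphism)
open import Algebra.Structures using (IsAbelianGroup; IsCommutativeRing)
open import Data.Fin.Base as Fin using (Fin; zero; suc; punchIn; pinch; _↑ˡ_; _↑ʳ_)
open import Data.List.Base as List using ([]; _∷_; replicate; _++_)
open import Data.List.Properties using (foldr-++)
open import Data.Nat.Base as ℕ using (ℕ; zero; suc)
open import Data.Product.Base using (∃; _×_; _,_)
open import Data.Sum.Base using (_⊎_; inj₁; inj₂)
open import Data.Vec.Functional as Vector using (Vector)
open import Data.Vec.Functional.Properties using (lookup-++ˡ; lookup-++ʳ)
open import Relation.Binary.PropositionalEquality as ≡ using (_≡_; _≢_)
open import Relation.Nullary using (yes; no; ¬?; contradiction)
open import Defs

-- The relation `A² = 2 A + 8 I` alone confines the eigenvalues to 4 and -2 and says nothing about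
-- multiplicities; the elimination produces the whole characteristic polynomial, with neither
-- diagonalisation nor a trace argument. It works because the rows of `B` are left eigenvectors of
-- `D`: `B D = β B` gives `B (X I - D) = (X - β) B`, so the lower block row with multiplier `B`
-- clears the upper right block. A Schur complement would need the inverse of `X I - D`; scaling the
-- upper rows by `X - β` instead stays inside the polynomial ring, at the price of a factor that
-- must later be cancelled. The constants come from the weight 4: `γ = 8` is `4 + 4`, `β = 2` is
-- half of 4. Since `X (X - 2) - 8 = (X - 4)(X + 2)` and `X² - 4 = (X - 2)(X + 2)`, the corner
-- supplies exactly the power of `X - 2` that the first elimination has introduced.

private
  variable
    k l m n : ℕ

-- Deleting two indices in either order

-- Once index `punchIn j s` is deleted, `pinch s j` is the position that `j` takes among the others.
punchIn-pinch : (j : Fin (suc n)) (s : Fin n) → punchIn (punchIn j s) (pinch s j) ≡ j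
punchIn-pinch {suc n} zero    s       = ≡.refl
punchIn-pinch {suc n} (suc j) zero    = ≡.refl
punchIn-pinch {suc n} (suc j) (suc s) = ≡.cong suc (punchIn-pinch j s)

-- Both sides enumerate in increasing order what remains after `j` and `punchIn j s` are removed. It
-- identifies the minors of exchanged pairs in a double Laplace expansion.
punchIn-comm : (j : Fin (suc (suc n))) (s : Fin (suc n)) (t : Fin n) →
               punchIn (punchIn j s) (punchIn (pinch s j) t) ≡ punchIn j (punchIn s t)
punchIn-comm zero    s       t       = ≡.refl
punchIn-comm (suc j) zero    t       = ≡.refl
punchIn-comm (suc j) (suc s) zero    = ≡.refl
punchIn-comm (suc j) (suc s) (suc t) = ≡.cong suc (punchIn-comm j s t)

-- Block matrices

↑-elim : ∀ {p} m {k} (P : Fin (m ℕ.+ k) → Set p) →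
         (∀ i → P (i ↑ˡ k)) → (∀ i → P (m ↑ʳ i)) → ∀ i → P i
↑-elim zero    P left right i       = right i
↑-elim (suc m) P left right zero    = left zero
↑-elim (suc m) P left right (suc i) = ↑-elim m (λ j → P (suc j)) (λ j → left (suc j)) right i

module _ {a} {C : Set a} (P : Matrix C m k) (Q : Matrix C m l) where

  ∥-↑ˡ : ∀ i j → (P ∥ Q) i (j ↑ˡ l) ≡ P i j
  ∥-↑ˡ i = lookup-++ˡ (P i) (Q i)

  ∥-↑ʳ : ∀ i j → (P ∥ Q) i (k ↑ʳ j) ≡ Q i j
  ∥-↑ʳ i = lookup-++ʳ (P i) (Q i)

module _ {a} {C : Set a} (P : Matrix C m k) (Q : Matrix C n k) where

  ⫽-↑ˡ : ∀ i j → (P ⫽ Q) (i ↑ˡ n) j ≡ P i j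
  ⫽-↑ˡ i j = ≡.cong (λ row → row j) (lookup-++ˡ P Q i)

  ⫽-↑ʳ : ∀ i j → (P ⫽ Q) (m ↑ʳ i) j ≡ Q i j
  ⫽-↑ʳ i j = ≡.cong (λ row → row j) (lookup-++ʳ P Q i)

module _ {a p} {C : Set a} (P : C → Set p) where

  ∥-all : (A : Matrix C m k) (B : Matrix C m l) →
          (∀ i j → P (A i j)) → (∀ i j → P (B i j)) → ∀ i j → P ((A ∥ B) i j)
  ∥-all {k = k} A B PA PB i j with Fin.splitAt k j
  ... | inj₁ j′ = PA i j′
  ... | inj₂ j′ = PB i j′

  ⫽-all : (A : Matrix C m k) (B : Matrix C n k) →
          (∀ i j → P (A i j)) → (∀ i j → P (B i j)) → ∀ i j → P ((A ⫽ B) i j)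
  ⫽-all {m = m} A B PA PB i j with Fin.splitAt m i
  ... | inj₁ i′ = PA i′ j
  ... | inj₂ i′ = PB i′ j

∥-ᵗ : ∀ {a} {C : Set a} (A : Matrix C m k) (B : Matrix C m l) →
      ∀ i j → (A ∥ B) i j ≡ (Vector.transpose A ⫽ Vector.transpose B) j i
∥-ᵗ {k = k} A B i j with Fin.splitAt k j
... | inj₁ j′ = ≡.refl
... | inj₂ j′ = ≡.refl

-- Taking the indices already split turns facts about blocks, such as symmetry, into plain pattern
-- matching on two sums.
quadrant : ∀ {a} {C : Set a} → Matrix C m k → Matrix C m l → Matrix C n k → Matrix C n l →
           Fin m ⊎ Fin n → Fin k ⊎ Fin l → C
quadrant P Q S T (inj₁ i) (inj₁ j) = P i j
quadrant P Q S T (inj₁ i) (inj₂ j) = Q i j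
quadrant P Q S T (inj₂ i) (inj₁ j) = S i j
quadrant P Q S T (inj₂ i) (inj₂ j) = T i j

module _ {a} {C : Set a}
  (P : Matrix C m k) (Q : Matrix C m l) (S : Matrix C n k) (T : Matrix C n l) where

  block-entry : ∀ i j → ((P ∥ Q) ⫽ (S ∥ T)) i j ≡ quadrant P Q S T (Fin.splitAt m i) (Fin.splitAt k j)
  block-entry i j with Fin.splitAt m i
  ... | inj₁ i′ with Fin.splitAt k j
  ...   | inj₁ j′ = ≡.refl
  ...   | inj₂ j′ = ≡.refl
  block-entry i j | inj₂ i′ with Fin.splitAt k j
  ...   | inj₁ j′ = ≡.refl
  ...   | inj₂ j′ = ≡.refl

  ∥-⫽-interchange : ∀ i j → ((P ∥ Q) ⫽ (S ∥ T)) i j ≡ ((P ⫽ S) ∥ (Q ⫽ T)) i j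
  ∥-⫽-interchange i j = ≡.trans (block-entry i j) (interchanged i j)
    where
    interchanged : ∀ i j → quadrant P Q S T (Fin.splitAt m i) (Fin.splitAt k j) ≡ ((P ⫽ S) ∥ (Q ⫽ T)) i j
    interchanged i j with Fin.splitAt k j
    ... | inj₁ j′ with Fin.splitAt m i
    ...   | inj₁ i′ = ≡.refl
    ...   | inj₂ i′ = ≡.refl
    interchanged i j | inj₂ j′ with Fin.splitAt m i
    ...   | inj₁ i′ = ≡.refl
    ...   | inj₂ i′ = ≡.refl

module _ {a} {C : Set a}
  (P : Matrix C m m) (Q : Matrix C m n) (S : Matrix C n m) (T : Matrix C n n) where

  block-symmetric : (∀ i j → P i j ≡ P j i) → (∀ i j → Q i j ≡ S j i) → (∀ i j → T i j ≡ T j i) →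
                    ∀ i j → ((P ∥ Q) ⫽ (S ∥ T)) i j ≡ ((P ∥ Q) ⫽ (S ∥ T)) j i
  block-symmetric P-sym Q≡Sᵗ T-sym i j = ≡.trans (block-entry P Q S T i j)
    (≡.trans (symmetric (Fin.splitAt m i) (Fin.splitAt m j)) (≡.sym (block-entry P Q S T j i)))
    where
    symmetric : ∀ x y → quadrant P Q S T x y ≡ quadrant P Q S T y x
    symmetric (inj₁ i) (inj₁ j) = P-sym i j
    symmetric (inj₁ i) (inj₂ j) = Q≡Sᵗ i j
    symmetric (inj₂ i) (inj₁ j) = ≡.sym (Q≡Sᵗ j i)
    symmetric (inj₂ i) (inj₂ j) = T-sym i j

  block-diagonal : ∀ {x} → (∀ i → P i i ≡ x) → (∀ i → T i i ≡ x) → ∀ i → ((P ∥ Q) ⫽ (S ∥ T)) i i ≡ x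
  -- `block-entry` is abstracted along with the split so that its type reduces to the chosen
  -- quadrant.
  block-diagonal P-diag T-diag i with Fin.splitAt m i | block-entry P Q S T i i
  ... | inj₁ i′ | entry = ≡.trans entry (P-diag i′)
  ... | inj₂ i′ | entry = ≡.trans entry (T-diag i′)

-- Matrix algebra over a commutative ring

module MatrixAlgebra {c ℓ} (R : CommutativeRing c ℓ) where

  open CommutativeRing R hiding (zero)
  open MatrixOps rawRing using () renaming (_≋_ to _≋ᴿ_; O to Oᴿ; I to Iᴿ; _·_ to _·ᴿ_; _∙_ to _∙ᴿ_)
  open import Algebra.Properties.CommutativeSemigroup *-commutativeSemigroup using (x∙yz≈y∙xz)
  open import Algebra.Properties.Semiring.Sum semiring
  open import Relation.Binary.Reasoning.Setoid setoid

  sum-zero : (f : Vector Carrier n) → (∀ i → f i ≈ 0#) → sum f ≈ 0#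
  sum-zero {n} f f≈0 = trans (sum-cong-≋ {x = f} f≈0) (sum-replicate-zero n)

  sum-↑ : ∀ m {k} (f : Vector Carrier (m ℕ.+ k)) →
          sum f ≈ sum (λ i → f (i ↑ˡ k)) + sum (λ i → f (m ↑ʳ i))
  sum-↑ zero    f = sym (+-identityˡ _)
  sum-↑ (suc m) f = trans (+-congˡ (sum-↑ m (λ i → f (suc i)))) (sym (+-assoc _ _ _))

  sum-*-I : (f : Vector Carrier n) (j : Fin n) → sum (λ r → f r * Iᴿ n r j) ≈ f j
  sum-*-I f zero    = trans
    (+-cong (*-identityʳ _) (sum-zero (λ r → f (suc r) * 0#) λ r → zeroʳ _)) (+-identityʳ _)
  sum-*-I f (suc j) = trans (+-cong (zeroʳ _) (sum-*-I (λ r → f (suc r)) j)) (+-identityˡ _)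

  I-↑ˡ↑ˡ : ∀ m {k} (i j : Fin m) → Iᴿ (m ℕ.+ k) (i ↑ˡ k) (j ↑ˡ k) ≡ Iᴿ m i j
  I-↑ˡ↑ˡ (suc m) zero    zero    = ≡.refl
  I-↑ˡ↑ˡ (suc m) zero    (suc j) = ≡.refl
  I-↑ˡ↑ˡ (suc m) (suc i) zero    = ≡.refl
  I-↑ˡ↑ˡ (suc m) (suc i) (suc j) = I-↑ˡ↑ˡ m i j

  I-↑ˡ↑ʳ : ∀ m {k} (i : Fin m) (j : Fin k) → Iᴿ (m ℕ.+ k) (i ↑ˡ k) (m ↑ʳ j) ≡ 0#
  I-↑ˡ↑ʳ (suc m) zero    j = ≡.refl
  I-↑ˡ↑ʳ (suc m) (suc i) j = I-↑ˡ↑ʳ m i j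

  I-↑ʳ↑ˡ : ∀ m {k} (i : Fin k) (j : Fin m) → Iᴿ (m ℕ.+ k) (m ↑ʳ i) (j ↑ˡ k) ≡ 0#
  I-↑ʳ↑ˡ (suc m) i zero    = ≡.refl
  I-↑ʳ↑ˡ (suc m) i (suc j) = I-↑ʳ↑ˡ m i j

  I-↑ʳ↑ʳ : ∀ m {k} (i j : Fin k) → Iᴿ (m ℕ.+ k) (m ↑ʳ i) (m ↑ʳ j) ≡ Iᴿ k i j
  I-↑ʳ↑ʳ zero    i j = ≡.refl
  I-↑ʳ↑ʳ (suc m) i j = I-↑ʳ↑ʳ m i j

  ·-assoc : (A : Matrix Carrier m k) (B : Matrix Carrier k l) (C : Matrix Carrier l n) →
            ((A ·ᴿ B) ·ᴿ C) ≋ᴿ (A ·ᴿ (B ·ᴿ C))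
  ·-assoc A B C i j = begin
    sum (λ s → sum (λ r → A i r * B r s) * C s j)
      ≈⟨ sum-cong-≋ (λ s → *-distribʳ-sum (C s j) (λ r → A i r * B r s)) ⟩
    sum (λ s → sum (λ r → A i r * B r s * C s j))
      ≈⟨ ∑-comm (λ s r → A i r * B r s * C s j) ⟩
    sum (λ r → sum (λ s → A i r * B r s * C s j))
      ≈⟨ sum-cong-≋ (λ r → sum-cong-≋ λ s → *-assoc (A i r) (B r s) (C s j)) ⟩
    sum (λ r → sum (λ s → A i r * (B r s * C s j)))
      ≈⟨ sum-cong-≋ (λ r → *-distribˡ-sum (A i r) (λ s → B r s * C s j)) ⟨
    sum (λ r → A i r * sum (λ s → B r s * C s j)) ∎

  ·-congˡ : (A : Matrix Carrier m k) {B C : Matrix Carrier k n} → B ≋ᴿ C → (A ·ᴿ B) ≋ᴿ (A ·ᴿ C)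
  ·-congˡ A B≋C i j = sum-cong-≋ λ r → *-congˡ (B≋C r j)

  ·-congʳ : {A B : Matrix Carrier m k} (C : Matrix Carrier k n) → A ≋ᴿ B → (A ·ᴿ C) ≋ᴿ (B ·ᴿ C)
  ·-congʳ C A≋B i j = sum-cong-≋ λ r → *-congʳ (A≋B i r)

  ·-identityˡ : (A : Matrix Carrier m n) → (Iᴿ m ·ᴿ A) ≋ᴿ A
  ·-identityˡ A zero    j = trans
    (+-cong (*-identityˡ _) (sum-zero (λ r → 0# * A (suc r) j) λ r → zeroˡ _)) (+-identityʳ _)
  ·-identityˡ A (suc i) j = trans
    (+-cong (zeroˡ _) (·-identityˡ (λ r → A (suc r)) i j)) (+-identityˡ _)

  ·-zeroʳ : (A : Matrix Carrier m k) → (A ·ᴿ Oᴿ k n) ≋ᴿ Oᴿ m n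
  ·-zeroʳ A i j = sum-zero (λ r → A i r * 0#) λ r → zeroʳ (A i r)

  ·-∙ : (x : Carrier) (A : Matrix Carrier m k) (B : Matrix Carrier k n) → (A ·ᴿ (x ∙ᴿ B)) ≋ᴿ (x ∙ᴿ (A ·ᴿ B))
  ·-∙ x A B i j = trans (sum-cong-≋ λ r → x∙yz≈y∙xz (A i r) x (B r j))
    (sym (*-distribˡ-sum x (λ r → A i r * B r j)))

  ∙-· : (x : Carrier) (A : Matrix Carrier m k) (B : Matrix Carrier k n) → ((x ∙ᴿ A) ·ᴿ B) ≋ᴿ (x ∙ᴿ (A ·ᴿ B))
  ∙-· x A B i j = trans (sum-cong-≋ λ r → *-assoc x (A i r) (B r j))
    (sym (*-distribˡ-sum x (λ r → A i r * B r j)))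

  module _ (A : Matrix Carrier n m) (B : Matrix Carrier m k) (C : Matrix Carrier m l) where

    ·-∥-↑ˡ : ∀ i j → (A ·ᴿ (B ∥ C)) i (j ↑ˡ l) ≈ (A ·ᴿ B) i j
    ·-∥-↑ˡ i j = sum-cong-≋ λ r → *-congˡ (reflexive (∥-↑ˡ B C r j))

    ·-∥-↑ʳ : ∀ i j → (A ·ᴿ (B ∥ C)) i (k ↑ʳ j) ≈ (A ·ᴿ C) i j
    ·-∥-↑ʳ i j = sum-cong-≋ λ r → *-congˡ (reflexive (∥-↑ʳ B C r j))

  ∥-·-⫽ : (A : Matrix Carrier m k) (B : Matrix Carrier m l)
          (C : Matrix Carrier k n) (D : Matrix Carrier l n) →
          ∀ i j → ((A ∥ B) ·ᴿ (C ⫽ D)) i j ≈ (A ·ᴿ C) i j + (B ·ᴿ D) i j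
  ∥-·-⫽ {k = k} A B C D i j = trans (sum-↑ k (λ r → (A ∥ B) i r * (C ⫽ D) r j)) (+-cong
    (sum-cong-≋ λ r → reflexive (≡.cong₂ _*_ (∥-↑ˡ A B i r) (⫽-↑ˡ C D r j)))
    (sum-cong-≋ λ r → reflexive (≡.cong₂ _*_ (∥-↑ʳ A B i r) (⫽-↑ʳ C D r j))))

-- Determinants

module Determinant {c ℓ} (R : CommutativeRing c ℓ) where

  open CommutativeRing R hiding (zero)
  open MatrixOps rawRing using (det; [-1]^) renaming (_≋_ to _≋ᴿ_; I to Iᴿ)
  open import Algebra.Properties.CommutativeSemiring.Exp commutativeSemiring using (_^_)
  open import Algebra.Properties.CommutativeSemigroup +-commutativeSemigroup using (interchange)
  open import Algebra.Properties.Ring ring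
  open import Algebra.Properties.Semiring.Sum semiring
  open MatrixAlgebra R
  open import Relation.Binary.Reasoning.Setoid setoid
  open import Algebra.Solver.CommutativeMonoid *-commutativeMonoid using (solve; _⊜_; _⊕_)

  -- The summands of `det` get a name so that they can be handed explicitly to the lemmas on sums.
  laplace : Matrix Carrier (suc n) (suc n) → Vector Carrier (suc n)
  laplace A j = [-1]^ j * (A zero j * det (λ r s → A (suc r) (punchIn j s)))

  det-cong : {A B : Matrix Carrier n n} → A ≋ᴿ B → det A ≈ det B
  det-cong {zero}          A≋B = refl
  det-cong {suc n} {A} {B} A≋B = sum-cong-≋ {x = laplace A} {laplace B} λ j →
    *-congˡ {[-1]^ j} (*-cong (A≋B zero j) (det-cong {n} λ r s → A≋B (suc r) (punchIn j s)))

  -- The minors of the expansion depend on `B` only, so linearity holds term by term. Linearity in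
  -- this one row is enough: every row operation below changes the first row.
  det-∷-+ : (u v : Vector Carrier (suc n)) (B : Matrix Carrier n (suc n)) →
            det ((λ j → u j + v j) Vector.∷ B) ≈ det (u Vector.∷ B) + det (v Vector.∷ B)
  det-∷-+ u v B = trans
    (sum-cong-≋ {x = laplace ((λ j → u j + v j) Vector.∷ B)} λ j →
      lemma ([-1]^ j) (u j) (v j) (det λ r s → B r (punchIn j s)))
    (∑-distrib-+ (laplace (u Vector.∷ B)) (laplace (v Vector.∷ B)))
    where
    lemma : ∀ s x y d → s * ((x + y) * d) ≈ s * (x * d) + s * (y * d)
    lemma s x y d = trans (*-congˡ (distribʳ d x y)) (distribˡ s (x * d) (y * d))

  det-∷-* : (x : Carrier) (v : Vector Carrier (suc n)) (B : Matrix Carrier n (suc n)) →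
            det ((λ j → x * v j) Vector.∷ B) ≈ x * det (v Vector.∷ B)
  det-∷-* x v B = trans
    (sum-cong-≋ {x = laplace ((λ j → x * v j) Vector.∷ B)} λ j →
      lemma ([-1]^ j) x (v j) (det λ r s → B r (punchIn j s)))
    (sym (*-distribˡ-sum x (laplace (v Vector.∷ B))))
    where
    lemma : ∀ s x y d → s * ((x * y) * d) ≈ x * (s * (y * d))
    lemma = solve 4 (λ s x y d → (s ⊕ ((x ⊕ y) ⊕ d)) ⊜ (x ⊕ (s ⊕ (y ⊕ d)))) refl

  det-∷-sum : (W : Matrix Carrier k (suc n)) (B : Matrix Carrier n (suc n)) →
              det ((λ j → sum (λ r → W r j)) Vector.∷ B) ≈ sum (λ r → det (W r Vector.∷ B))
  det-∷-sum {zero}  W B = sum-zero (laplace ((λ _ → 0#) Vector.∷ B)) λ j →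
    trans (*-congˡ {[-1]^ j} (zeroˡ (det λ r s → B r (punchIn j s)))) (zeroʳ ([-1]^ j))
  det-∷-sum {suc k} W B = trans (det-∷-+ (W zero) (λ j → sum (λ r → W (suc r) j)) B)
    (+-congˡ (det-∷-sum (λ r → W (suc r)) B))

  -- (j , s) ↦ (punchIn j s , pinch s j) exchanges the two members of the ordered pair of
  -- distinct indices j and punchIn j s.
  sum-cancel : (F : Fin (suc n) → Fin n → Carrier) →
               (∀ j s → F j s + F (punchIn j s) (pinch s j) ≈ 0#) →
               sum (λ j → sum (F j)) ≈ 0#
  sum-cancel {zero}  F cancel = +-identityʳ 0#
  sum-cancel {suc n} F cancel = begin
    sum (F zero) + sum (λ j → F (suc j) zero + sum (λ s → F (suc j) (suc s)))
      ≈⟨ +-congˡ (∑-distrib-+ (λ j → F (suc j) zero) (λ j → sum (λ s → F (suc j) (suc s)))) ⟩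
    sum (F zero) + (sum (λ j → F (suc j) zero) + sum (λ j → sum (λ s → F (suc j) (suc s))))
      ≈⟨ +-congˡ (+-congˡ (sum-cancel (λ j s → F (suc j) (suc s)) λ j s → cancel (suc j) (suc s))) ⟩
    sum (F zero) + (sum (λ j → F (suc j) zero) + 0#)
      ≈⟨ +-congˡ (+-identityʳ _) ⟩
    sum (F zero) + sum (λ j → F (suc j) zero)
      ≈⟨ ∑-distrib-+ (F zero) (λ j → F (suc j) zero) ⟨
    sum (λ s → F zero s + F (suc s) zero)
      ≈⟨ sum-zero (λ s → F zero s + F (suc s) zero) (cancel zero) ⟩
    0# ∎

  -- Exactly one of two distinct indices moves by one when the other is deleted, so the exponents
  -- `j + s` and `punchIn j s + pinch s j` differ by one.
  [-1]^-swap : (j : Fin (suc n)) (s : Fin n) →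
               [-1]^ (punchIn j s) * [-1]^ (pinch s j) ≈ - ([-1]^ j * [-1]^ s)
  [-1]^-swap {suc n} zero    s    = begin
    - [-1]^ s * 1#     ≈⟨ *-comm _ _ ⟩
    1# * - [-1]^ s     ≈⟨ -‿distribʳ-* _ _ ⟨
    - (1# * [-1]^ s)   ∎
  [-1]^-swap {suc n} (suc j) zero = begin
    1# * [-1]^ j           ≈⟨ -‿involutive _ ⟨
    - - (1# * [-1]^ j)     ≈⟨ -‿cong (-‿distribʳ-* _ _) ⟩
    - (1# * - [-1]^ j)     ≈⟨ -‿cong (*-comm _ _) ⟩
    - (- [-1]^ j * 1#)     ∎
  [-1]^-swap {suc n} (suc j) (suc s) = begin
    - [-1]^ (punchIn j s) * - [-1]^ (pinch s j) ≈⟨ -x*-y _ _ ⟩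
    [-1]^ (punchIn j s) * [-1]^ (pinch s j)     ≈⟨ [-1]^-swap j s ⟩
    - ([-1]^ j * [-1]^ s)                       ≈⟨ -‿cong (-x*-y _ _) ⟨
    - (- [-1]^ j * - [-1]^ s)                   ∎
    where
    -x*-y : ∀ x y → - x * - y ≈ x * y
    -x*-y x y = begin
      - x * - y     ≈⟨ -‿distribˡ-* x (- y) ⟨
      - (x * - y)   ≈⟨ -‿cong (-‿distribʳ-* x y) ⟨
      - - (x * y)   ≈⟨ -‿involutive _ ⟩
      x * y         ∎

  module _ (B : Matrix Carrier n (suc (suc n))) where

    laplace₂-term : (u v : Vector Carrier (suc (suc n))) → Fin (suc (suc n)) → Fin (suc n) → Carrier
    laplace₂-term u v j s =
      ([-1]^ j * [-1]^ s) * ((u j * v (punchIn j s)) * det (λ r t → B r (punchIn j (punchIn s t))))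

    -- Expanding the first two rows sums over ordered pairs of distinct columns, `j` for `u` and
    -- `punchIn j s` for `v`.
    laplace₂ : ∀ u v → det (u Vector.∷ v Vector.∷ B) ≈ sum (λ j → sum (laplace₂-term u v j))
    laplace₂ u v = sum-cong-≋ {x = laplace (u Vector.∷ v Vector.∷ B)} {λ j → sum (laplace₂-term u v j)} λ j → begin
      [-1]^ j * (u j * sum (λ s → [-1]^ s * (v (punchIn j s) * D j s)))
        ≈⟨ *-congˡ (*-distribˡ-sum (u j) (λ s → [-1]^ s * (v (punchIn j s) * D j s))) ⟩
      [-1]^ j * sum (λ s → u j * ([-1]^ s * (v (punchIn j s) * D j s)))
        ≈⟨ *-distribˡ-sum ([-1]^ j) (λ s → u j * ([-1]^ s * (v (punchIn j s) * D j s))) ⟩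
      sum (λ s → [-1]^ j * (u j * ([-1]^ s * (v (punchIn j s) * D j s))))
        ≈⟨ sum-cong-≋ {y = laplace₂-term u v j} (λ s → lemma ([-1]^ j) (u j) ([-1]^ s) (v (punchIn j s)) (D j s)) ⟩
      sum (laplace₂-term u v j) ∎
      where
      D : Fin (suc (suc n)) → Fin (suc n) → Carrier
      D j s = det (λ r t → B r (punchIn j (punchIn s t)))
      lemma : ∀ a x b y d → a * (x * (b * (y * d))) ≈ (a * b) * ((x * y) * d)
      lemma = solve 5 (λ a x b y d → (a ⊕ (x ⊕ (b ⊕ (y ⊕ d)))) ⊜ ((a ⊕ b) ⊕ ((x ⊕ y) ⊕ d))) refl

    -- Exchanging the two columns together with the two rows keeps the entries and the minor and
    -- reverses the sign.
    laplace₂-term-swap : ∀ u v j s →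
      laplace₂-term u v j s + laplace₂-term v u (punchIn j s) (pinch s j) ≈ 0#
    laplace₂-term-swap u v j s = begin
      a * (x * y * d) + a′ * (y * u (punchIn (punchIn j s) (pinch s j)) * d′)
        ≈⟨ +-congˡ (*-cong ([-1]^-swap j s) (*-cong
             (*-congˡ (reflexive (≡.cong u (punchIn-pinch j s))))
             (det-cong λ r t → reflexive (≡.cong (B r) (punchIn-comm j s t))))) ⟩
      a * (x * y * d) + - a * (y * x * d)
        ≈⟨ +-congˡ (*-congˡ (*-congʳ (*-comm y x))) ⟩
      a * (x * y * d) + - a * (x * y * d)
        ≈⟨ +-congˡ (-‿distribˡ-* _ _) ⟨
      a * (x * y * d) + - (a * (x * y * d))
        ≈⟨ -‿inverseʳ _ ⟩
      0# ∎
      where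
      a = [-1]^ j * [-1]^ s
      a′ = [-1]^ (punchIn j s) * [-1]^ (pinch s j)
      x = u j
      y = v (punchIn j s)
      d = det (λ r t → B r (punchIn j (punchIn s t)))
      d′ = det (λ r t → B r (punchIn (punchIn j s) (punchIn (pinch s j) t)))

    -- A term of one determinant cancels the term of the other at the exchanged column pair, so the
    -- two expansions are added termwise before `sum-cancel` applies.
    det-swap : ∀ u v → det (u Vector.∷ v Vector.∷ B) + det (v Vector.∷ u Vector.∷ B) ≈ 0#
    det-swap u v = begin
      det (u Vector.∷ v Vector.∷ B) + det (v Vector.∷ u Vector.∷ B)
        ≈⟨ +-cong (laplace₂ u v) (laplace₂ v u) ⟩
      sum (λ j → sum (T u v j)) + sum (λ j → sum (T v u j))
        ≈⟨ ∑-distrib-+ (λ j → sum (T u v j)) (λ j → sum (T v u j)) ⟨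
      sum (λ j → sum (T u v j) + sum (T v u j))
        ≈⟨ sum-cong-≋ {x = λ j → sum (λ s → T u v j s + T v u j s)} (λ j → ∑-distrib-+ (T u v j) (T v u j)) ⟨
      sum (λ j → sum (λ s → T u v j s + T v u j s))
        ≈⟨ sum-cancel (λ j s → T u v j s + T v u j s) (λ j s → begin
             (T u v j s + T v u j s) + (T u v (punchIn j s) (pinch s j) + T v u (punchIn j s) (pinch s j))
               ≈⟨ lemma (T u v j s) (T v u j s) (T u v (punchIn j s) (pinch s j)) _ ⟩
             (T u v j s + T v u (punchIn j s) (pinch s j)) + (T v u j s + T u v (punchIn j s) (pinch s j))
               ≈⟨ +-cong (laplace₂-term-swap u v j s) (laplace₂-term-swap v u j s) ⟩
             0# + 0#
               ≈⟨ +-identityʳ 0# ⟩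
             0# ∎) ⟩
      0# ∎
      where
      T = laplace₂-term
      lemma : ∀ a b c d → (a + b) + (c + d) ≈ (a + d) + (b + c)
      lemma a b c d = trans (+-congˡ (+-comm c d)) (interchange a b d c)

  -- Equal rows at the top cancel in pairs within a single expansion; `det-swap` would only give
  -- `det A + det A ≈ 0#`, and 2 may be a zero divisor. Otherwise, exchanging the top two rows
  -- pushes row 0 into the minors, where it is again the first row and repeated further down.
  det-repeated-row : (i : Fin n) (A : Matrix Carrier (suc n) (suc n)) →
                     (∀ j → A zero j ≈ A (suc i) j) → det A ≈ 0#
  det-repeated-row {suc n} zero A A₀≈A₁ = begin
    det A
      ≈⟨ laplace₂ B (A zero) (A (suc zero)) ⟩
    sum (λ j → sum (T (A (suc zero)) j))
      ≈⟨ sum-cong-≋ {x = λ j → sum (T (A zero) j)} (λ j → sum-cong-≋ {x = T (A zero) j} λ s →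
           *-congˡ {[-1]^ j * [-1]^ s} (*-congʳ {det λ r t → B r (punchIn j (punchIn s t))}
             (*-congˡ {A zero j} (A₀≈A₁ (punchIn j s))))) ⟨
    sum (λ j → sum (T (A zero) j))
      ≈⟨ sum-cancel (T (A zero)) (laplace₂-term-swap B (A zero) (A zero)) ⟩
    0# ∎
    where
    B : Matrix Carrier n (suc (suc n))
    B r = A (suc (suc r))
    T : Vector Carrier (suc (suc n)) → Fin (suc (suc n)) → Fin (suc n) → Carrier
    T = laplace₂-term B (A zero)
  det-repeated-row {suc n} (suc i) A A₀≈Aᵢ = begin
    det A
      ≈⟨ +-identityʳ _ ⟨
    det A + 0#
      ≈⟨ +-congˡ (sum-zero (laplace A′) λ j → trans (*-congˡ {[-1]^ j} (trans (*-congˡ {A (suc zero) j}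
           (det-repeated-row i (λ r s → A′ (suc r) (punchIn j s)) λ s → A₀≈Aᵢ (punchIn j s)))
           (zeroʳ (A (suc zero) j)))) (zeroʳ ([-1]^ j))) ⟨
    det A + det A′
      ≈⟨ det-swap B (A zero) (A (suc zero)) ⟩
    0# ∎
    where
    B : Matrix Carrier n (suc (suc n))
    B r = A (suc (suc r))
    A′ : Matrix Carrier (suc (suc n)) (suc (suc n))
    A′ = A (suc zero) Vector.∷ A zero Vector.∷ B

  det-diagonal-row : (A : Matrix Carrier (suc n) (suc n)) (x : Carrier) →
                     (∀ j → A zero j ≈ x * Iᴿ (suc n) zero j) →
                     det A ≈ x * det (λ r s → A (suc r) (suc s))
  det-diagonal-row A x A₀≈ = begin
    1# * (A zero zero * D) + sum (λ j → laplace A (suc j))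
      ≈⟨ +-cong (trans (*-identityˡ _) (*-congʳ (trans (A₀≈ zero) (*-identityʳ x))))
           (sum-zero (λ j → laplace A (suc j)) λ j → trans (*-congˡ {[-1]^ (suc j)} (trans
             (*-congʳ {det λ r s → A (suc r) (punchIn (suc j) s)} (trans (A₀≈ (suc j)) (zeroʳ x)))
             (zeroˡ _))) (zeroʳ _)) ⟩
    x * D + 0#
      ≈⟨ +-identityʳ _ ⟩
    x * D ∎
    where D = det (λ r s → A (suc r) (suc s))

  det-scalar : ∀ n {A : Matrix Carrier n n} (x : Carrier) →
               (∀ i j → A i j ≈ x * Iᴿ n i j) → det A ≈ x ^ n
  det-scalar zero    x A≈ = refl
  det-scalar (suc n) {A} x A≈ = trans (det-diagonal-row A x (A≈ zero))
    (*-congˡ (det-scalar n x λ i j → A≈ (suc i) (suc j)))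

  -- By linearity each added multiple contributes a determinant with a repeated row. The factor `x`
  -- on the first row takes the place of dividing by a pivot.
  det-row-operation : (A : Matrix Carrier (suc n) (suc n)) (x : Carrier)
                      (y : Vector Carrier k) (ι : Fin k → Fin n) →
                      det ((λ j → x * A zero j + sum (λ r → y r * A (suc (ι r)) j)) Vector.∷ Vector.tail A)
                      ≈ x * det A
  det-row-operation A x y ι = begin
    det ((λ j → x * A zero j + sum (λ r → y r * A (suc (ι r)) j)) Vector.∷ B)
      ≈⟨ det-∷-+ (λ j → x * A zero j) (λ j → sum (λ r → y r * A (suc (ι r)) j)) B ⟩
    det ((λ j → x * A zero j) Vector.∷ B) + det ((λ j → sum (λ r → y r * A (suc (ι r)) j)) Vector.∷ B)
      ≈⟨ +-cong (det-∷-* x (A zero) B) (det-∷-sum (λ r j → y r * A (suc (ι r)) j) B) ⟩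
    x * det A + sum (λ r → det ((λ j → y r * A (suc (ι r)) j) Vector.∷ B))
      ≈⟨ +-congˡ (sum-zero (λ r → det ((λ j → y r * A (suc (ι r)) j) Vector.∷ B)) λ r →
           trans (det-∷-* (y r) (A (suc (ι r))) B)
           (trans (*-congˡ (det-repeated-row (ι r) (A (suc (ι r)) Vector.∷ B) λ j → refl)) (zeroʳ (y r)))) ⟩
    x * det A + 0#
      ≈⟨ +-identityʳ _ ⟩
    x * det A ∎
    where B = Vector.tail A

  -- One upper row at a time becomes `e` times a unit vector, and expansion along it removes its row
  -- and column. Since only lower rows are ever added, the remaining upper rows still satisfy the
  -- hypothesis.
  det-block-elimination : ∀ m {k} (M : Matrix Carrier (m ℕ.+ k) (m ℕ.+ k)) (E : Matrix Carrier m k) (d e : Carrier) →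
    (∀ i j → d * M (i ↑ˡ k) j + sum (λ r → E i r * M (m ↑ʳ r) j) ≈ e * Iᴿ (m ℕ.+ k) (i ↑ˡ k) j) →
    d ^ m * det M ≈ e ^ m * det (λ r s → M (m ↑ʳ r) (m ↑ʳ s))
  det-block-elimination zero    M E d e rows = refl
  det-block-elimination (suc m) M E d e rows = begin
    d * d ^ m * det M
      ≈⟨ lemma d (d ^ m) (det M) ⟩
    d ^ m * (d * det M)
      ≈⟨ *-congˡ (det-row-operation M d (E zero) (m ↑ʳ_)) ⟨
    d ^ m * det M′
      ≈⟨ *-congˡ (det-diagonal-row M′ e (rows zero)) ⟩
    d ^ m * (e * det (λ r s → M (suc r) (suc s)))
      ≈⟨ lemma₂ (d ^ m) e _ ⟩
    e * (d ^ m * det (λ r s → M (suc r) (suc s)))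
      ≈⟨ *-congˡ (det-block-elimination m (λ r s → M (suc r) (suc s)) (λ i → E (suc i)) d e
           λ i j → rows (suc i) (suc j)) ⟩
    e * (e ^ m * D)
      ≈⟨ *-assoc e (e ^ m) D ⟨
    e * e ^ m * D ∎
    where
    D = det (λ r s → M (suc m ↑ʳ r) (suc m ↑ʳ s))
    M′ = (λ j → d * M zero j + sum (λ r → E zero r * M (suc (m ↑ʳ r)) j)) Vector.∷ Vector.tail M
    lemma : ∀ x y z → x * y * z ≈ y * (x * z)
    lemma = solve 3 (λ x y z → ((x ⊕ y) ⊕ z) ⊜ (y ⊕ (x ⊕ z))) refl
    lemma₂ : ∀ x y z → x * (y * z) ≈ y * (x * z)
    lemma₂ = solve 3 (λ x y z → (x ⊕ (y ⊕ z)) ⊜ (y ⊕ (x ⊕ z))) refl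

-- Polynomials

module PolynomialRing {c ℓ} (R : CommutativeRing c ℓ) where

  open CommutativeRing R hiding (zero; _-_)
  open Polynomial rawRing renaming (_≈ₚ_ to infix 4 _≈ₚ_; _+ₚ_ to infixl 6 _+ₚ_; _*ₚ_ to infixl 7 _*ₚ_)
  open import Algebra.Properties.Ring ring using (-0#≈0#; -‿distribˡ-*; x∙y⁻¹≈ε⇒x≈y)

  -- Unlike p ≈ₚ q, which unfolds, p ≃ q determines p and q, so that they can stay implicit.
  infix 4 _≃_
  record _≃_ (p q : Poly) : Set ℓ where
    constructor ⟪_⟫
    field coefficients : p ≈ₚ q
  open _≃_

  coeff-+ₚ : ∀ p q k → coeff (p +ₚ q) k ≈ coeff p k + coeff q k
  coeff-+ₚ []      q       k       = sym (+-identityˡ _)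
  coeff-+ₚ (a ∷ p) []      k       = sym (+-identityʳ _)
  coeff-+ₚ (a ∷ p) (b ∷ q) zero    = refl
  coeff-+ₚ (a ∷ p) (b ∷ q) (suc k) = coeff-+ₚ p q k

  coeff-scale : ∀ a p k → coeff (List.map (a *_) p) k ≈ a * coeff p k
  coeff-scale a []      k       = sym (zeroʳ a)
  coeff-scale a (b ∷ p) zero    = refl
  coeff-scale a (b ∷ p) (suc k) = coeff-scale a p k

  coeff-neg : ∀ p k → coeff (List.map -_ p) k ≈ - coeff p k
  coeff-neg []      k       = sym -0#≈0#
  coeff-neg (a ∷ p) zero    = refl
  coeff-neg (a ∷ p) (suc k) = coeff-neg p k

  -- `coeff` embeds polynomials into sequences, injectively because `_≃_` is coefficientwise
  -- equality, so the additive laws are inherited from the pointwise group.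
  +ₚ-isAbelianGroup : IsAbelianGroup _≃_ _+ₚ_ [] (List.map -_)
  +ₚ-isAbelianGroup = GroupMonomorphism.isAbelianGroup
    {G₁ = record { Carrier = Poly ; _≈_ = _≃_ ; _∙_ = _+ₚ_ ; ε = [] ; _⁻¹ = List.map -_ }}
    {G₂ = record { Carrier = ℕ → Carrier ; _≈_ = λ f g → ∀ k → f k ≈ g k
                 ; _∙_ = λ f g k → f k + g k ; ε = λ _ → 0# ; _⁻¹ = λ f k → - f k }}
    {⟦_⟧ = coeff}
    (record
      { isGroupHomomorphism = record
        { isMonoidHomomorphism = record
          { isMagmaHomomorphism = record
            { isRelHomomorphism = record { cong = coefficients }
            ; homo = coeff-+ₚ
            }
          ; ε-homo = λ _ → refl
          }
        ; ⁻¹-homo = coeff-neg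
        }
      ; injective = ⟪_⟫
      })
    (Pointwise.isAbelianGroup ℕ +-isAbelianGroup)

  +ₚ-abelianGroup : AbelianGroup c ℓ
  +ₚ-abelianGroup = record { isAbelianGroup = +ₚ-isAbelianGroup }

  open AbelianGroup +ₚ-abelianGroup public using () renaming
    ( setoid to ≃-setoid; refl to ≃-refl; sym to ≃-sym; trans to ≃-trans
    ; ∙-cong to +ₚ-cong; ∙-congˡ to +ₚ-congˡ; identityˡ to +ₚ-identityˡ; identityʳ to +ₚ-identityʳ
    ; commutativeSemigroup to +ₚ-commutativeSemigroup)
  open import Algebra.Properties.CommutativeSemigroup +ₚ-commutativeSemigroup using (interchange)
  open import Relation.Binary.Reasoning.Setoid ≃-setoid

  scale : Carrier → Poly → Poly
  scale a = List.map (a *_)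

  shift : Poly → Poly
  shift p = 0# ∷ p

  ∷-cong : ∀ {a b p q} → a ≈ b → p ≃ q → a ∷ p ≃ b ∷ q
  ∷-cong a≈b ⟪ p≈q ⟫ = ⟪ (λ { zero → a≈b ; (suc k) → p≈q k }) ⟫

  shift-cong : ∀ {p q} → p ≃ q → shift p ≃ shift q
  shift-cong = ∷-cong refl

  shift-[] : shift [] ≃ []
  shift-[] = ⟪ (λ { zero → refl ; (suc k) → refl }) ⟫

  shift-+ₚ : ∀ p q → shift (p +ₚ q) ≃ shift p +ₚ shift q
  shift-+ₚ p q = ∷-cong (sym (+-identityˡ 0#)) ≃-refl

  scale-cong : ∀ {a b p q} → a ≈ b → p ≃ q → scale a p ≃ scale b q
  scale-cong {a} {b} {p} {q} a≈b ⟪ p≈q ⟫ = ⟪ (λ k →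
    trans (coeff-scale a p k) (trans (*-cong a≈b (p≈q k)) (sym (coeff-scale b q k)))) ⟫

  scale-+ₚ : ∀ a p q → scale a (p +ₚ q) ≃ scale a p +ₚ scale a q
  scale-+ₚ a []      q       = ≃-refl
  scale-+ₚ a (b ∷ p) []      = ≃-refl
  scale-+ₚ a (b ∷ p) (d ∷ q) = ∷-cong (distribˡ a b d) (scale-+ₚ a p q)

  scale-* : ∀ a b p → scale (a * b) p ≃ scale a (scale b p)
  scale-* a b []      = ≃-refl
  scale-* a b (d ∷ p) = ∷-cong (*-assoc a b d) (scale-* a b p)

  scale-0# : ∀ p → scale 0# p ≃ []
  scale-0# p = ⟪ (λ k → trans (coeff-scale 0# p k) (zeroˡ _)) ⟫

  scale-1# : ∀ p → scale 1# p ≃ p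
  scale-1# p = ⟪ (λ k → trans (coeff-scale 1# p k) (*-identityˡ _)) ⟫

  *ₚ-congˡ : ∀ p {q r} → q ≃ r → p *ₚ q ≃ p *ₚ r
  *ₚ-congˡ []      q≃r = ≃-refl
  *ₚ-congˡ (a ∷ p) q≃r = +ₚ-cong (scale-cong refl q≃r) (shift-cong (*ₚ-congˡ p q≃r))

  *ₚ-zeroʳ : ∀ p → p *ₚ [] ≃ []
  *ₚ-zeroʳ []      = ≃-refl
  *ₚ-zeroʳ (a ∷ p) = ≃-trans (shift-cong (*ₚ-zeroʳ p)) shift-[]

  -- The defining recursion of `_*ₚ_`, mirrored to the right factor; commutativity follows by
  -- comparing the two.
  *ₚ-∷ : ∀ p b q → p *ₚ (b ∷ q) ≃ scale b p +ₚ shift (p *ₚ q)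
  *ₚ-∷ []      b q = ≃-sym shift-[]
  *ₚ-∷ (a ∷ p) b q = ∷-cong (+-congʳ (*-comm a b)) (begin
    scale a q +ₚ p *ₚ (b ∷ q)                      ≈⟨ +ₚ-congˡ (*ₚ-∷ p b q) ⟩
    scale a q +ₚ (scale b p +ₚ shift (p *ₚ q))     ≈⟨ x∙yz≈y∙xz (scale a q) (scale b p) _ ⟩
    scale b p +ₚ (scale a q +ₚ shift (p *ₚ q))     ∎)
    where open import Algebra.Properties.CommutativeSemigroup +ₚ-commutativeSemigroup using (x∙yz≈y∙xz)

  *ₚ-comm : ∀ p q → p *ₚ q ≃ q *ₚ p
  *ₚ-comm []      q = ≃-sym (*ₚ-zeroʳ q)
  *ₚ-comm (a ∷ p) q = ≃-trans (+ₚ-congˡ (shift-cong (*ₚ-comm p q))) (≃-sym (*ₚ-∷ q a p))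

  *ₚ-congʳ : ∀ p {q r} → q ≃ r → q *ₚ p ≃ r *ₚ p
  *ₚ-congʳ p {q} {r} q≃r = ≃-trans (*ₚ-comm q p) (≃-trans (*ₚ-congˡ p q≃r) (*ₚ-comm p r))

  *ₚ-distribˡ : ∀ p q r → p *ₚ (q +ₚ r) ≃ p *ₚ q +ₚ p *ₚ r
  *ₚ-distribˡ []      q r = ≃-refl
  *ₚ-distribˡ (a ∷ p) q r = begin
    scale a (q +ₚ r) +ₚ shift (p *ₚ (q +ₚ r))
      ≈⟨ +ₚ-cong (scale-+ₚ a q r) (≃-trans (shift-cong (*ₚ-distribˡ p q r)) (shift-+ₚ (p *ₚ q) (p *ₚ r))) ⟩
    (scale a q +ₚ scale a r) +ₚ (shift (p *ₚ q) +ₚ shift (p *ₚ r))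
      ≈⟨ interchange (scale a q) (scale a r) (shift (p *ₚ q)) _ ⟩
    (scale a q +ₚ shift (p *ₚ q)) +ₚ (scale a r +ₚ shift (p *ₚ r)) ∎

  *ₚ-distribʳ : ∀ p q r → (q +ₚ r) *ₚ p ≃ q *ₚ p +ₚ r *ₚ p
  *ₚ-distribʳ p q r = begin
    (q +ₚ r) *ₚ p       ≈⟨ *ₚ-comm (q +ₚ r) p ⟩
    p *ₚ (q +ₚ r)       ≈⟨ *ₚ-distribˡ p q r ⟩
    p *ₚ q +ₚ p *ₚ r    ≈⟨ +ₚ-cong (*ₚ-comm p q) (*ₚ-comm p r) ⟩
    q *ₚ p +ₚ r *ₚ p    ∎

  shift-*ₚ : ∀ p q → shift p *ₚ q ≃ shift (p *ₚ q)
  shift-*ₚ p q = ≃-trans (+ₚ-cong (scale-0# q) ≃-refl) (+ₚ-identityˡ _)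

  scale-*ₚ : ∀ a p q → scale a p *ₚ q ≃ scale a (p *ₚ q)
  scale-*ₚ a []      q = ≃-refl
  scale-*ₚ a (b ∷ p) q = begin
    scale (a * b) q +ₚ shift (scale a p *ₚ q)
      ≈⟨ +ₚ-cong (scale-* a b q) (∷-cong (sym (zeroʳ a)) (scale-*ₚ a p q)) ⟩
    scale a (scale b q) +ₚ scale a (shift (p *ₚ q))
      ≈⟨ scale-+ₚ a (scale b q) (shift (p *ₚ q)) ⟨
    scale a (scale b q +ₚ shift (p *ₚ q)) ∎

  *ₚ-assoc : ∀ p q r → (p *ₚ q) *ₚ r ≃ p *ₚ (q *ₚ r)
  *ₚ-assoc []      q r = ≃-refl
  *ₚ-assoc (a ∷ p) q r = begin
    (scale a q +ₚ shift (p *ₚ q)) *ₚ r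
      ≈⟨ *ₚ-distribʳ r (scale a q) (shift (p *ₚ q)) ⟩
    scale a q *ₚ r +ₚ shift (p *ₚ q) *ₚ r
      ≈⟨ +ₚ-cong (scale-*ₚ a q r) (≃-trans (shift-*ₚ (p *ₚ q) r) (shift-cong (*ₚ-assoc p q r))) ⟩
    scale a (q *ₚ r) +ₚ shift (p *ₚ (q *ₚ r)) ∎

  *ₚ-identityˡ : ∀ p → constant 1# *ₚ p ≃ p
  *ₚ-identityˡ p = ≃-trans (+ₚ-cong (scale-1# p) shift-[]) (+ₚ-identityʳ p)

  isCommutativeRing-≃ : IsCommutativeRing _≃_ _+ₚ_ _*ₚ_ (List.map -_) [] (constant 1#)
  isCommutativeRing-≃ = record
    { isRing = record
      { +-isAbelianGroup = +ₚ-isAbelianGroup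
      ; *-cong = λ {p} {q} {r} {s} p≃q r≃s → ≃-trans (*ₚ-congˡ p r≃s) (*ₚ-congʳ s p≃q)
      ; *-assoc = *ₚ-assoc
      ; *-identity = *ₚ-identityˡ , λ p → ≃-trans (*ₚ-comm p (constant 1#)) (*ₚ-identityˡ p)
      ; distrib = *ₚ-distribˡ , *ₚ-distribʳ
      }
    ; *-comm = *ₚ-comm
    }

  ≃-commutativeRing : CommutativeRing c ℓ
  ≃-commutativeRing = record { isCommutativeRing = isCommutativeRing-≃ }

  -- The identity map carries the laws from `_≃_` back to `polyRawRing`, the raw ring in which
  -- `HasSpectrum` is stated.
  polynomialRing : CommutativeRing c ℓ
  polynomialRing = record
    { isCommutativeRing = RingMonomorphism.isCommutativeRing
        {R₁ = polyRawRing} {R₂ = CommutativeRing.rawRing ≃-commutativeRing} {⟦_⟧ = λ p → p}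
        (record
          { isRingHomomorphism = record
            { isSemiringHomomorphism = record
              { isNearSemiringHomomorphism = record
                { +-isMonoidHomomorphism = record
                  { isMagmaHomomorphism = record
                    { isRelHomomorphism = record { cong = ⟪_⟫ }
                    ; homo = λ _ _ → ≃-refl
                    }
                  ; ε-homo = ≃-refl
                  }
                ; *-homo = λ _ _ → ≃-refl
                }
              ; 1#-homo = ≃-refl
              }
            ; -‿homo = λ _ → ≃-refl
            }
          ; injective = coefficients
          })
        isCommutativeRing-≃
    }

  constant-isRingHomomorphism : IsRingHomomorphism rawRing polyRawRing constant
  constant-isRingHomomorphism = record
    { isSemiringHomomorphism = record
      { isNearSemiringHomomorphism = record
        { +-isMonoidHomomorphism = record
          { isMagmaHomomorphism = record
            { isRelHomomorphism = record { cong = λ a≈b → coefficients (∷-cong a≈b ≃-refl) }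
            ; homo = λ _ _ _ → refl
            }
          ; ε-homo = coefficients shift-[]
          }
        ; *-homo = λ a b → coefficients (∷-cong (sym (+-identityʳ (a * b))) ≃-refl)
        }
      ; 1#-homo = λ _ → refl
      }
    ; -‿homo = λ _ _ → refl
    }

  -- The recurrence runs downwards from the end of the list, beyond which every coefficient is zero.
  geometric-coefficients⇒0 : ∀ a p → (∀ k → coeff p k ≈ a * coeff p (suc k)) → p ≃ []
  geometric-coefficients⇒0 a []      geometric = ≃-refl
  geometric-coefficients⇒0 a (b ∷ p) geometric = ≃-trans (∷-cong b≈0 p≃0) shift-[]
    where
    p≃0 : p ≃ []
    p≃0 = geometric-coefficients⇒0 a p λ k → geometric (suc k)
    b≈0 : b ≈ 0#
    b≈0 = trans (geometric zero) (trans (*-congˡ (coefficients p≃0 zero)) (zeroʳ a))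

  private
    X-constant : Carrier → Poly
    X-constant a = X +ₚ List.map -_ (constant a)

  -- Coefficient `suc k` of the product is `coeff p k` minus `a * coeff p (suc k)`; its vanishing is
  -- the downward recurrence above.
  [X-a]*p≃0⇒p≃0 : ∀ a p → X-constant a *ₚ p ≃ [] → p ≃ []
  [X-a]*p≃0⇒p≃0 a p ⟪ eq ⟫ = geometric-coefficients⇒0 a p λ k → x∙y⁻¹≈ε⇒x≈y _ _
    (trans (+-comm _ _) (trans (+-cong (linear k) (sym (coefficients (*ₚ-identityˡ p) k)))
      (trans (sym (coeff-+ₚ (scale (0# + - a) p) (shift (constant 1# *ₚ p)) (suc k))) (eq (suc k)))))
    where
    linear : ∀ k → - (a * coeff p (suc k)) ≈ coeff (scale (0# + - a) p) (suc k)
    linear k = trans (-‿distribˡ-* a _)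
      (trans (*-congʳ (sym (+-identityˡ (- a)))) (sym (coeff-scale (0# + - a) p (suc k))))

  [X-a]-cancelˡ : ∀ a p q → X-constant a *ₚ p ≈ₚ X-constant a *ₚ q → p ≈ₚ q
  [X-a]-cancelˡ a p q eq = coefficients (p-q≃0⇒p≃q p q ([X-a]*p≃0⇒p≃0 a _
    (≃-trans (x[y-z]≈xy-xz (X-constant a) p q) (p≃q⇒p-q≃0 {X-constant a *ₚ p} {X-constant a *ₚ q} ⟪ eq ⟫))))
    where
    open import Algebra.Properties.Ring (CommutativeRing.ring ≃-commutativeRing)
      using (x[y-z]≈xy-xz) renaming (x∙y⁻¹≈ε⇒x≈y to p-q≃0⇒p≃q; x≈y⇒x∙y⁻¹≈ε to p≃q⇒p-q≃0)

-- Characteristic polynomials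

module CharacteristicMatrix
  {a ℓ₁ b ℓ₂} (R : CommutativeRing a ℓ₁) (S : CommutativeRing b ℓ₂)
  {c : CommutativeRing.Carrier R → CommutativeRing.Carrier S}
  (c-homo : IsRingHomomorphism (CommutativeRing.rawRing R) (CommutativeRing.rawRing S) c)
  (X : CommutativeRing.Carrier S)
  where

  private
    module R = CommutativeRing R
    module Rᴹ = MatrixOps R.rawRing
  open CommutativeRing S hiding (zero)
  open IsRingHomomorphism c-homo
  open MatrixOps rawRing using (det) renaming (I to Iˢ)
  open MatrixAlgebra S
  open Determinant S
  open import Algebra.Definitions.RawMonoid R.+-rawMonoid using () renaming (sum to sumᴿ)
  open import Algebra.Properties.CommutativeSemiring.Exp commutativeSemiring using (_^_)
  open import Algebra.Properties.CommutativeSemigroup *-commutativeSemigroup using (x∙yz≈y∙xz)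
  open import Algebra.Properties.Ring ring
  open import Algebra.Properties.Semiring.Sum semiring
  open import Relation.Binary.Reasoning.Setoid setoid

  -- For `c = constant` and the indeterminate `X` this is definitionally the matrix whose
  -- determinant is `charPoly A`.
  charMatrix : Matrix R.Carrier n n → Matrix Carrier n n
  charMatrix {n} A i j = X * Iˢ n i j + - c (A i j)

  charMatrix-cong : {A B : Matrix R.Carrier n n} → A Rᴹ.≋ B →
                    ∀ i j → charMatrix A i j ≈ charMatrix B i j
  charMatrix-cong A≋B i j = +-congˡ (-‿cong (⟦⟧-cong (A≋B i j)))

  charMatrix-entry : ∀ (A : Matrix R.Carrier n n) {i j δ y} → Iˢ n i j ≡ δ → A i j ≡ y →
                     charMatrix A i j ≈ X * δ + - c y
  charMatrix-entry A ≡.refl ≡.refl = refl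

  I-homo : (i j : Fin n) → c (Rᴹ.I n i j) ≈ Iˢ n i j
  I-homo zero    zero    = 1#-homo
  I-homo zero    (suc j) = 0#-homo
  I-homo (suc i) zero    = 0#-homo
  I-homo (suc i) (suc j) = I-homo i j

  neg-homo-0# : - c R.0# ≈ 0#
  neg-homo-0# = trans (-‿cong 0#-homo) -0#≈0#

  sum-neg-homo : (f : Vector R.Carrier n) → sum (λ i → - c (f i)) ≈ - c (sumᴿ f)
  sum-neg-homo {zero}  f = sym neg-homo-0#
  sum-neg-homo {suc n} f = begin
    - c (f zero) + sum (λ i → - c (f (suc i)))        ≈⟨ +-congˡ (sum-neg-homo (λ i → f (suc i))) ⟩
    - c (f zero) + - c (sumᴿ (λ i → f (suc i)))       ≈⟨ -‿+-comm _ _ ⟩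
    - (c (f zero) + c (sumᴿ (λ i → f (suc i))))       ≈⟨ -‿cong (+-homo _ _) ⟨
    - c (sumᴿ f)                                      ∎

  homo-*-neg : ∀ x y → c x * - c y ≈ - c (x R.* y)
  homo-*-neg x y = trans (sym (-‿distribʳ-* (c x) (c y))) (-‿cong (sym (*-homo x y)))

  -- (X − β) times the first block row of X I − A plus B times the second one is (X (X − β) − γ) times
  -- the first block row of I.
  charMatrix-deflation :
    (B : Matrix R.Carrier m k) (C : Matrix R.Carrier k m) (D : Matrix R.Carrier k k) (β γ : R.Carrier) →
    (B Rᴹ.· C) Rᴹ.≋ (γ Rᴹ.∙ Rᴹ.I m) → (B Rᴹ.· D) Rᴹ.≋ (β Rᴹ.∙ B) →
    (X + - c β) ^ m * det (charMatrix ((Rᴹ.O m m ∥ B) ⫽ (C ∥ D)))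
    ≈ ((X + - c β) * X + - c γ) ^ m * det (charMatrix D)
  charMatrix-deflation {m} {k} B C D β γ BC≋γI BD≋βB = trans
    (det-block-elimination m M (λ i r → c (B i r)) d e λ i →
      ↑-elim m (λ j → d * M (i ↑ˡ k) j + sum (λ r → c (B i r) * M (m ↑ʳ r) j)
                      ≈ e * Iˢ (m ℕ.+ k) (i ↑ˡ k) j) (left i) (right i))
    (*-congˡ (det-cong M-↑ʳ↑ʳ))
    where
    O′ = Rᴹ.O m m
    A = (O′ ∥ B) ⫽ (C ∥ D)
    M = charMatrix A
    d = X + - c β
    e = d * X + - c γ

    M-↑ˡ↑ˡ : ∀ i j → M (i ↑ˡ k) (j ↑ˡ k) ≈ X * Iˢ m i j + - c R.0#
    M-↑ˡ↑ˡ i j = charMatrix-entry A (I-↑ˡ↑ˡ m i j)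
      (≡.trans (⫽-↑ˡ (O′ ∥ B) (C ∥ D) i (j ↑ˡ k)) (∥-↑ˡ O′ B i j))
    M-↑ˡ↑ʳ : ∀ i j → M (i ↑ˡ k) (m ↑ʳ j) ≈ X * 0# + - c (B i j)
    M-↑ˡ↑ʳ i j = charMatrix-entry A (I-↑ˡ↑ʳ m i j)
      (≡.trans (⫽-↑ˡ (O′ ∥ B) (C ∥ D) i (m ↑ʳ j)) (∥-↑ʳ O′ B i j))
    M-↑ʳ↑ˡ : ∀ i j → M (m ↑ʳ i) (j ↑ˡ k) ≈ X * 0# + - c (C i j)
    M-↑ʳ↑ˡ i j = charMatrix-entry A (I-↑ʳ↑ˡ m i j)
      (≡.trans (⫽-↑ʳ (O′ ∥ B) (C ∥ D) i (j ↑ˡ k)) (∥-↑ˡ C D i j))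
    M-↑ʳ↑ʳ : ∀ i j → M (m ↑ʳ i) (m ↑ʳ j) ≈ X * Iˢ k i j + - c (D i j)
    M-↑ʳ↑ʳ i j = charMatrix-entry A (I-↑ʳ↑ʳ m i j)
      (≡.trans (⫽-↑ʳ (O′ ∥ B) (C ∥ D) i (m ↑ʳ j)) (∥-↑ʳ C D i j))

    -- In the left column block, `d X I - B C` equals `(d X - γ) I`, which is where `e` comes from.
    left : ∀ i j → d * M (i ↑ˡ k) (j ↑ˡ k) + sum (λ r → c (B i r) * M (m ↑ʳ r) (j ↑ˡ k))
                   ≈ e * Iˢ (m ℕ.+ k) (i ↑ˡ k) (j ↑ˡ k)
    left i j = begin
      d * M (i ↑ˡ k) (j ↑ˡ k) + sum (λ r → c (B i r) * M (m ↑ʳ r) (j ↑ˡ k))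
        ≈⟨ +-cong
             (*-congˡ (trans (M-↑ˡ↑ˡ i j) (trans (+-congˡ neg-homo-0#) (+-identityʳ _))))
             (sum-cong-≋ λ r → trans
               (*-congˡ (trans (M-↑ʳ↑ˡ r j) (trans (+-congʳ (zeroʳ X)) (+-identityˡ _))))
               (homo-*-neg (B i r) (C r j))) ⟩
      d * (X * Iˢ m i j) + sum (λ r → - c (B i r R.* C r j))
        ≈⟨ +-congˡ (sum-neg-homo (λ r → B i r R.* C r j)) ⟩
      d * (X * Iˢ m i j) + - c ((B Rᴹ.· C) i j)
        ≈⟨ +-congˡ (-‿cong (trans (⟦⟧-cong (BC≋γI i j)) (trans (*-homo γ _) (*-congˡ (I-homo i j))))) ⟩
      d * (X * Iˢ m i j) + - (c γ * Iˢ m i j)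
        ≈⟨ +-cong (sym (*-assoc d X _)) (-‿distribˡ-* (c γ) _) ⟩
      d * X * Iˢ m i j + - c γ * Iˢ m i j
        ≈⟨ distribʳ (Iˢ m i j) (d * X) (- c γ) ⟨
      e * Iˢ m i j
        ≡⟨ ≡.cong (e *_) (I-↑ˡ↑ˡ m i j) ⟨
      e * Iˢ (m ℕ.+ k) (i ↑ˡ k) (j ↑ˡ k) ∎

    -- In the right column block, `- d B + B (X I - D)` is `- d B + (X - β) B`, so the choice
    -- `d = X - β` makes it vanish.
    right : ∀ i j → d * M (i ↑ˡ k) (m ↑ʳ j) + sum (λ r → c (B i r) * M (m ↑ʳ r) (m ↑ʳ j))
                    ≈ e * Iˢ (m ℕ.+ k) (i ↑ˡ k) (m ↑ʳ j)
    right i j = begin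
      d * M (i ↑ˡ k) (m ↑ʳ j) + sum (λ r → c (B i r) * M (m ↑ʳ r) (m ↑ʳ j))
        ≈⟨ +-cong
             (*-congˡ (trans (M-↑ˡ↑ʳ i j) (trans (+-congʳ (zeroʳ X)) (+-identityˡ _))))
             (sum-cong-≋ λ r → trans (*-congˡ (M-↑ʳ↑ʳ r j)) (trans (distribˡ (c (B i r)) _ _)
               (+-cong (x∙yz≈y∙xz (c (B i r)) X (Iˢ k r j)) (homo-*-neg (B i r) (D r j))))) ⟩
      d * - b′ + sum (λ r → X * (c (B i r) * Iˢ k r j) + - c (B i r R.* D r j))
        ≈⟨ +-cong (sym (-‿distribʳ-* d b′))
             (∑-distrib-+ (λ r → X * (c (B i r) * Iˢ k r j)) (λ r → - c (B i r R.* D r j))) ⟩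
      - (d * b′) + (sum (λ r → X * (c (B i r) * Iˢ k r j)) + sum (λ r → - c (B i r R.* D r j)))
        ≈⟨ +-congˡ (+-cong
             (trans (sym (*-distribˡ-sum X (λ r → c (B i r) * Iˢ k r j)))
               (*-congˡ (sum-*-I (λ r → c (B i r)) j)))
             (trans (sum-neg-homo (λ r → B i r R.* D r j))
               (-‿cong (trans (⟦⟧-cong (BD≋βB i j)) (*-homo β (B i j)))))) ⟩
      - (d * b′) + (X * b′ + - (c β * b′))
        ≈⟨ +-congˡ (+-congˡ (-‿distribˡ-* (c β) b′)) ⟩
      - (d * b′) + (X * b′ + - c β * b′)
        ≈⟨ +-congˡ (distribʳ b′ X (- c β)) ⟨
      - (d * b′) + d * b′
        ≈⟨ -‿inverseˡ (d * b′) ⟩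
      0#
        ≈⟨ zeroʳ e ⟨
      e * 0#
        ≡⟨ ≡.cong (e *_) (I-↑ˡ↑ʳ m i j) ⟨
      e * Iˢ (m ℕ.+ k) (i ↑ˡ k) (m ↑ʳ j) ∎
      where b′ = c (B i j)

  det-charMatrix-O : ∀ n → det (charMatrix (Rᴹ.O n n)) ≈ X ^ n
  det-charMatrix-O n = det-scalar n X λ i j → trans (+-congˡ neg-homo-0#) (+-identityʳ _)

-- Cancelling powers and collecting linear factors

module PowerCancellation {c ℓ} (S : CommutativeRing c ℓ) where

  open CommutativeRing S hiding (zero)
  open import Algebra.Properties.CommutativeSemiring.Exp commutativeSemiring
    using (_^_; ^-homo-*; ^-distrib-*; ^-congˡ)
  open import Algebra.Solver.CommutativeMonoid *-commutativeMonoid using (solve; _⊜_; _⊕_)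
  open import Relation.Binary.Reasoning.Setoid setoid

  ^-cancelˡ : ∀ {d} → (∀ p q → d * p ≈ d * q → p ≈ q) → ∀ n p q → d ^ n * p ≈ d ^ n * q → p ≈ q
  ^-cancelˡ {d} cancel zero    p q eq = trans (sym (*-identityˡ p)) (trans eq (*-identityˡ q))
  ^-cancelˡ {d} cancel (suc n) p q eq = ^-cancelˡ cancel n p q (cancel _ _
    (trans (sym (*-assoc d _ p)) (trans eq (*-assoc d _ q))))

  foldr-replicate : ∀ {a} {A : Set a} (f : A → Carrier) n x y →
                    List.foldr (λ z p → f z * p) y (replicate n x) ≈ f x ^ n * y
  foldr-replicate f zero    x y = sym (*-identityˡ y)
  foldr-replicate f (suc n) x y = trans (*-congˡ (foldr-replicate f n x y)) (sym (*-assoc _ _ y))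

  foldr-replicate-++ : ∀ {a} {A : Set a} (f : A → Carrier) n₁ n₂ x y →
                       List.foldr (λ z p → f z * p) 1# (replicate n₁ x ++ replicate n₂ y)
                       ≈ f x ^ n₁ * f y ^ n₂
  foldr-replicate-++ f n₁ n₂ x y = begin
    List.foldr (λ z p → f z * p) 1# (replicate n₁ x ++ replicate n₂ y)
      ≡⟨ foldr-++ (λ z p → f z * p) 1# (replicate n₁ x) (replicate n₂ y) ⟩
    List.foldr (λ z p → f z * p) (List.foldr (λ z p → f z * p) 1# (replicate n₂ y)) (replicate n₁ x)
      ≈⟨ foldr-replicate f n₁ x _ ⟩
    f x ^ n₁ * List.foldr (λ z p → f z * p) 1# (replicate n₂ y)
      ≈⟨ *-congˡ (trans (foldr-replicate f n₂ y 1#) (*-identityʳ _)) ⟩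
    f x ^ n₁ * f y ^ n₂ ∎

  -- Here `p`, `q`, `r` stand for the characteristic polynomials of `𝒜 W₁ W₂`, of its corner and of
  -- `O`, while `s` and `t` stand for `X - 4` and `X + 2`. Cancelling `d₂ ^ m` gives
  -- `q ≈ (d₁ * t) ^ m`; put into the first equation, this supplies the `d₁ ^ m` to be cancelled
  -- there and a second `t ^ m`.
  cancel-deflations : ∀ m (d₁ d₂ s t e₁ e₂ x p q r : Carrier) →
    (∀ y z → d₁ * y ≈ d₁ * z → y ≈ z) → (∀ y z → d₂ * y ≈ d₂ * z → y ≈ z) →
    e₁ ≈ s * t → e₂ ≈ d₁ * t → x ≈ d₂ → r ≈ x ^ m →
    d₁ ^ m * p ≈ e₁ ^ m * q → d₂ ^ m * q ≈ e₂ ^ m * r →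
    p ≈ s ^ m * t ^ (2 ℕ.* m)
  cancel-deflations m d₁ d₂ s t e₁ e₂ x p q r cancel₁ cancel₂ e₁≈ e₂≈ x≈ r≈ eq₁ eq₂ =
    ^-cancelˡ cancel₁ m _ _ (begin
      d₁ ^ m * p
        ≈⟨ eq₁ ⟩
      e₁ ^ m * q
        ≈⟨ *-cong (trans (^-congˡ m e₁≈) (^-distrib-* s t m)) (trans q≈ (^-distrib-* d₁ t m)) ⟩
      (s ^ m * t ^ m) * (d₁ ^ m * t ^ m)
        ≈⟨ solve 3 (λ x y z → (x ⊕ y) ⊕ (z ⊕ y) ⊜ z ⊕ (x ⊕ (y ⊕ y))) refl (s ^ m) (t ^ m) (d₁ ^ m) ⟩
      d₁ ^ m * (s ^ m * (t ^ m * t ^ m))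
        -- `2 ℕ.* m` unfolds to `m ℕ.+ (m ℕ.+ 0)`, hence the trivial factor `t ^ 0`.
        ≈⟨ *-congˡ (*-congˡ (*-congˡ (trans (^-homo-* t m 0) (*-identityʳ _)))) ⟨
      d₁ ^ m * (s ^ m * (t ^ m * t ^ (m ℕ.+ 0)))
        ≈⟨ *-congˡ (*-congˡ (^-homo-* t m (m ℕ.+ 0))) ⟨
      d₁ ^ m * (s ^ m * t ^ (2 ℕ.* m)) ∎)
    where
    q≈ : q ≈ (d₁ * t) ^ m
    q≈ = ^-cancelˡ cancel₂ m _ _ (begin
      d₂ ^ m * q               ≈⟨ eq₂ ⟩
      e₂ ^ m * r               ≈⟨ *-cong (^-congˡ m e₂≈) (trans r≈ (^-congˡ m x≈)) ⟩
      (d₁ * t) ^ m * d₂ ^ m    ≈⟨ *-comm _ _ ⟩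
      d₂ ^ m * (d₁ * t) ^ m    ∎)

-- The signed graph of two semi-orthogonal weighing matrices

open import Data.Integer.Base as ℤ using (+_)
open import Data.Nat.Base using (_+_; _*_)
open import Data.Rational.Base as ℚ using (ℚ; 0ℚ; 1ℚ; ½; _/_; -_; ↥_)
import Data.Rational.Properties as ℚ
open ≡ using (refl; sym; trans; cong; cong₂; module ≡-Reasoning)

IsSignValue : ℚ → Set
IsSignValue x = x ≡ 0ℚ ⊎ x ≡ 1ℚ ⊎ x ≡ - 1ℚ

fromSignedMatrix : (A : Matrix ℚ n n) → (∀ i j → A i j ≡ A j i) → (∀ i → A i i ≡ 0ℚ) →
                   (∀ i j → IsSignValue (A i j)) → ∃ λ (G : SignedGraph n) → adjacencyMatrix G ≋ A
fromSignedMatrix {n} A A-sym A-diag A-entries = G , adjacency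
  where
  G : SignedGraph n
  G = record
    { Adj        = λ i j → A i j ≢ 0ℚ
    ; adj?       = λ i j → ¬? (A i j ℚ.≟ 0ℚ)
    ; adj-sym    = λ {i} {j} Aij≢0 Aji≡0 → Aij≢0 (trans (A-sym i j) Aji≡0)
    ; adj-irrefl = λ { {i} refl Aii≢0 → Aii≢0 (A-diag i) }
    -- On an edge the entry is 1 or -1, so the sign of its numerator determines it. Ignoring the
    -- adjacency proof leaves only symmetry of `A` to check in `σ-sym`.
    ; σ          = λ {i} {j} _ → ℤ.sign (↥ A i j)
    ; σ-sym      = λ {i} {j} _ _ → cong (λ x → ℤ.sign (↥ x)) (A-sym i j)
    }
  adjacency : adjacencyMatrix G ≋ A
  adjacency i j with A i j ℚ.≟ 0ℚ | A-entries i j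
  ... | yes Aij≡0 | _                     = sym Aij≡0
  ... | no  Aij≢0 | inj₁ Aij≡0            = contradiction Aij≡0 Aij≢0
  ... | no  _     | inj₂ (inj₁ Aij≡1)     = trans (cong (λ x → signValue (ℤ.sign (↥ x))) Aij≡1) (sym Aij≡1)
  ... | no  _     | inj₂ (inj₂ Aij≡-1)    = trans (cong (λ x → signValue (ℤ.sign (↥ x))) Aij≡-1) (sym Aij≡-1)

-- Block identities from the weighing conditions

private
  ℚ-ring = ℚ.+-*-commutativeRing

open MatrixAlgebra ℚ-ring

-- Regrouping to `½ (W Wᵗ) V` lets the weight 4 meet the factor `½`: this is the origin of `β = 2`.
·-½·-weighing : (W V : Matrix ℚ m m) → W · W ᵗ ≋ (+ 4 / 1) ∙ I m →
                W · (½ ∙ (W ᵗ · V)) ≋ (+ 2 / 1) ∙ V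
·-½·-weighing W V WWᵗ≋4I i j = begin
  (W · (½ ∙ (W ᵗ · V))) i j             ≡⟨ ·-∙ ½ W (W ᵗ · V) i j ⟩
  ½ ℚ.* (W · (W ᵗ · V)) i j             ≡⟨ cong (½ ℚ.*_) (·-assoc W (W ᵗ) V i j) ⟨
  ½ ℚ.* (W · W ᵗ · V) i j               ≡⟨ cong (½ ℚ.*_) (·-congʳ V WWᵗ≋4I i j) ⟩
  ½ ℚ.* (((+ 4 / 1) ∙ I _) · V) i j     ≡⟨ cong (½ ℚ.*_) (∙-· (+ 4 / 1) (I _) V i j) ⟩
  ½ ℚ.* ((+ 4 / 1) ℚ.* (I _ · V) i j)   ≡⟨ cong (λ x → ½ ℚ.* ((+ 4 / 1) ℚ.* x)) (·-identityˡ V i j) ⟩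
  ½ ℚ.* ((+ 4 / 1) ℚ.* V i j)           ≡⟨ ℚ.*-assoc ½ (+ 4 / 1) (V i j) ⟨
  (+ 2 / 1) ℚ.* V i j                   ∎
  where open ≡-Reasoning

module _ (W₁ W₂ : Matrix ℚ m m) (semi : SemiOrthogonal W₁ W₂) where

  open SemiOrthogonal semi
  open IsWeighing weighing₁ using () renaming (entries to entries₁; CCᵗ≋αI to W₁W₁ᵗ≋4I; CᵗC≋αI to W₁ᵗW₁≋4I)
  open IsWeighing weighing₂ using () renaming (entries to entries₂; CCᵗ≋αI to W₂W₂ᵗ≋4I)
  open ≡-Reasoning

  upper lower : Matrix ℚ m m
  upper = ½ ∙ (W₁ ᵗ · W₂)
  lower = ½ ∙ (W₂ ᵗ · W₁)

  corner : Matrix ℚ (m + m) (m + m)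
  corner = (O m m ∥ upper) ⫽ (lower ∥ O m m)

  𝒜′ : Matrix ℚ (m + (m + m)) (m + (m + m))
  𝒜′ = (O m m ∥ (W₁ ∥ W₂)) ⫽ ((W₁ ᵗ ⫽ W₂ ᵗ) ∥ corner)

  -- `𝒜` stacks three block rows, whereas the elimination needs a two-by-two partition. Only the two
  -- lower block rows have to be regrouped.
  𝒜-blocks : 𝒜′ ≋ 𝒜 W₁ W₂
  𝒜-blocks i j with Fin.splitAt m i
  ... | inj₁ i′ = refl
  ... | inj₂ i′ = sym (∥-⫽-interchange (W₁ ᵗ) (O m m ∥ upper) (W₂ ᵗ) (lower ∥ O m m) i′ j)

  upper≡lowerᵗ : ∀ i j → upper i j ≡ lower j i
  upper≡lowerᵗ i j = cong (½ ℚ.*_) (sum-cong-≋ λ r → ℚ.*-comm (W₁ r i) (W₂ r j))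
    where open import Algebra.Properties.Semiring.Sum (CommutativeRing.semiring ℚ-ring) using (sum-cong-≋)

  -- Halving the values 0, 2 and -2 that semi-orthogonality allows makes this block a signed
  -- adjacency block.
  upper-entries : ∀ i j → IsSignValue (upper i j)
  upper-entries i j with entries i j
  ... | inj₁ x≡0          = inj₁ (cong (½ ℚ.*_) x≡0)
  ... | inj₂ (inj₁ x≡2)   = inj₂ (inj₁ (cong (½ ℚ.*_) x≡2))
  ... | inj₂ (inj₂ x≡-2)  = inj₂ (inj₂ (cong (½ ℚ.*_) x≡-2))

  𝒜-signedGraph : ∃ λ (G : SignedGraph (m + (m + m))) → adjacencyMatrix G ≋ 𝒜 W₁ W₂
  𝒜-signedGraph with fromSignedMatrix 𝒜′ 𝒜′-sym 𝒜′-diag 𝒜′-entries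
    where
    𝒜′-sym : ∀ i j → 𝒜′ i j ≡ 𝒜′ j i
    𝒜′-sym = block-symmetric (O m m) (W₁ ∥ W₂) (W₁ ᵗ ⫽ W₂ ᵗ) corner (λ _ _ → refl) (∥-ᵗ W₁ W₂)
      (block-symmetric (O m m) upper lower (O m m) (λ _ _ → refl) upper≡lowerᵗ (λ _ _ → refl))
    𝒜′-diag : ∀ i → 𝒜′ i i ≡ 0ℚ
    𝒜′-diag = block-diagonal (O m m) (W₁ ∥ W₂) (W₁ ᵗ ⫽ W₂ ᵗ) corner (λ _ → refl)
      (block-diagonal (O m m) upper lower (O m m) (λ _ → refl) (λ _ → refl))
    O-entries : ∀ i j → IsSignValue (O m m i j)
    O-entries _ _ = inj₁ refl
    lower-entries : ∀ i j → IsSignValue (lower i j)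
    lower-entries i j rewrite sym (upper≡lowerᵗ j i) = upper-entries j i
    𝒜′-entries : ∀ i j → IsSignValue (𝒜′ i j)
    𝒜′-entries = ⫽-all IsSignValue (O m m ∥ (W₁ ∥ W₂)) ((W₁ ᵗ ⫽ W₂ ᵗ) ∥ corner)
      (∥-all IsSignValue (O m m) (W₁ ∥ W₂) O-entries (∥-all IsSignValue W₁ W₂ entries₁ entries₂))
      (∥-all IsSignValue (W₁ ᵗ ⫽ W₂ ᵗ) corner
        (⫽-all IsSignValue (W₁ ᵗ) (W₂ ᵗ) (λ i j → entries₁ j i) (λ i j → entries₂ j i))
        (⫽-all IsSignValue (O m m ∥ upper) (lower ∥ O m m)
          (∥-all IsSignValue (O m m) upper O-entries upper-entries)
          (∥-all IsSignValue lower (O m m) lower-entries O-entries)))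
  ... | G , G≋𝒜′ = G , λ i j → trans (G≋𝒜′ i j) (𝒜-blocks i j)

  [W₁∥W₂]·[W₁ᵗ⫽W₂ᵗ] : (W₁ ∥ W₂) · (W₁ ᵗ ⫽ W₂ ᵗ) ≋ (+ 8 / 1) ∙ I m
  [W₁∥W₂]·[W₁ᵗ⫽W₂ᵗ] i j = begin
    ((W₁ ∥ W₂) · (W₁ ᵗ ⫽ W₂ ᵗ)) i j                    ≡⟨ ∥-·-⫽ W₁ W₂ (W₁ ᵗ) (W₂ ᵗ) i j ⟩
    (W₁ · W₁ ᵗ) i j ℚ.+ (W₂ · W₂ ᵗ) i j                ≡⟨ cong₂ ℚ._+_ (W₁W₁ᵗ≋4I i j) (W₂W₂ᵗ≋4I i j) ⟩
    (+ 4 / 1) ℚ.* I m i j ℚ.+ (+ 4 / 1) ℚ.* I m i j    ≡⟨ ℚ.*-distribʳ-+ (I m i j) (+ 4 / 1) (+ 4 / 1) ⟨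
    (+ 8 / 1) ℚ.* I m i j                              ∎

  -- Each half of the result comes from the other half of the row: `W₂ · lower` is twice `W₁`, and
  -- `W₁ · upper` is twice `W₂`.
  [W₁∥W₂]·corner : (W₁ ∥ W₂) · corner ≋ (+ 2 / 1) ∙ (W₁ ∥ W₂)
  [W₁∥W₂]·corner i = ↑-elim m (λ j → ((W₁ ∥ W₂) · corner) i j ≡ (+ 2 / 1) ℚ.* (W₁ ∥ W₂) i j)
    (λ j → begin
      ((W₁ ∥ W₂) · corner) i (j ↑ˡ m)
        ≡⟨ ∥-·-⫽ W₁ W₂ (O m m ∥ upper) (lower ∥ O m m) i (j ↑ˡ m) ⟩
      (W₁ · (O m m ∥ upper)) i (j ↑ˡ m) ℚ.+ (W₂ · (lower ∥ O m m)) i (j ↑ˡ m)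
        ≡⟨ cong₂ ℚ._+_ (·-∥-↑ˡ W₁ (O m m) upper i j) (·-∥-↑ˡ W₂ lower (O m m) i j) ⟩
      (W₁ · O m m) i j ℚ.+ (W₂ · lower) i j
        ≡⟨ cong₂ ℚ._+_ (·-zeroʳ W₁ i j) (·-½·-weighing W₂ W₁ W₂W₂ᵗ≋4I i j) ⟩
      0ℚ ℚ.+ (+ 2 / 1) ℚ.* W₁ i j
        ≡⟨ ℚ.+-identityˡ _ ⟩
      (+ 2 / 1) ℚ.* W₁ i j
        ≡⟨ cong ((+ 2 / 1) ℚ.*_) (∥-↑ˡ W₁ W₂ i j) ⟨
      (+ 2 / 1) ℚ.* (W₁ ∥ W₂) i (j ↑ˡ m) ∎)
    (λ j → begin
      ((W₁ ∥ W₂) · corner) i (m ↑ʳ j)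
        ≡⟨ ∥-·-⫽ W₁ W₂ (O m m ∥ upper) (lower ∥ O m m) i (m ↑ʳ j) ⟩
      (W₁ · (O m m ∥ upper)) i (m ↑ʳ j) ℚ.+ (W₂ · (lower ∥ O m m)) i (m ↑ʳ j)
        ≡⟨ cong₂ ℚ._+_ (·-∥-↑ʳ W₁ (O m m) upper i j) (·-∥-↑ʳ W₂ lower (O m m) i j) ⟩
      (W₁ · upper) i j ℚ.+ (W₂ · O m m) i j
        ≡⟨ cong₂ ℚ._+_ (·-½·-weighing W₁ W₂ W₁W₁ᵗ≋4I i j) (·-zeroʳ W₂ i j) ⟩
      (+ 2 / 1) ℚ.* W₂ i j ℚ.+ 0ℚ
        ≡⟨ ℚ.+-identityʳ _ ⟩
      (+ 2 / 1) ℚ.* W₂ i j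
        ≡⟨ cong ((+ 2 / 1) ℚ.*_) (∥-↑ʳ W₁ W₂ i j) ⟨
      (+ 2 / 1) ℚ.* (W₁ ∥ W₂) i (m ↑ʳ j) ∎)

  upper·lower : upper · lower ≋ (+ 4 / 1) ∙ I m
  upper·lower i j = begin
    (upper · lower) i j
      ≡⟨ ∙-· ½ (W₁ ᵗ · W₂) lower i j ⟩
    ½ ℚ.* (W₁ ᵗ · W₂ · lower) i j
      ≡⟨ cong (½ ℚ.*_) (·-assoc (W₁ ᵗ) W₂ lower i j) ⟩
    ½ ℚ.* (W₁ ᵗ · (W₂ · lower)) i j
      ≡⟨ cong (½ ℚ.*_) (·-congˡ (W₁ ᵗ) (·-½·-weighing W₂ W₁ W₂W₂ᵗ≋4I) i j) ⟩
    ½ ℚ.* (W₁ ᵗ · ((+ 2 / 1) ∙ W₁)) i j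
      ≡⟨ cong (½ ℚ.*_) (·-∙ (+ 2 / 1) (W₁ ᵗ) W₁ i j) ⟩
    ½ ℚ.* ((+ 2 / 1) ℚ.* (W₁ ᵗ · W₁) i j)
      ≡⟨ cong (λ x → ½ ℚ.* ((+ 2 / 1) ℚ.* x)) (W₁ᵗW₁≋4I i j) ⟩
    ½ ℚ.* ((+ 2 / 1) ℚ.* ((+ 4 / 1) ℚ.* I m i j))
      ≡⟨ ℚ.*-assoc ½ (+ 2 / 1) ((+ 4 / 1) ℚ.* I m i j) ⟨
    1ℚ ℚ.* ((+ 4 / 1) ℚ.* I m i j)
      ≡⟨ ℚ.*-identityˡ _ ⟩
    (+ 4 / 1) ℚ.* I m i j ∎

  upper·O : upper · O m m ≋ 0ℚ ∙ upper
  upper·O i j = trans (·-zeroʳ {n = m} upper i j) (sym (ℚ.*-zeroˡ (upper i j)))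

-- The characteristic polynomial of `𝒜 W₁ W₂`

module ℚ[X] = PolynomialRing ℚ-ring
private
  ℚ[X]-ring = ℚ[X].polynomialRing
  module P = CommutativeRing ℚ[X]-ring
open Polynomial ℚ.+-*-rawRing using (constant; X)
open CharacteristicMatrix ℚ-ring ℚ[X]-ring ℚ[X].constant-isRingHomomorphism X
open PowerCancellation ℚ[X]-ring
open Determinant ℚ[X]-ring using (det-cong)
open MatrixOps P.rawRing using (det)
open import Algebra.Properties.CommutativeSemiring.Exp P.commutativeSemiring using (_^_)

private
  X- : ℚ → P.Carrier
  X- a = X P.+ P.- constant a

-- Both sides are closed coefficient lists, so evaluation settles the coefficients up to degree 2
-- and all higher ones are zero.
quadratic₁ : X- (+ 2 / 1) P.* X P.+ P.- constant (+ 8 / 1) P.≈ X- (+ 4 / 1) P.* X- (- (+ 2 / 1))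
quadratic₁ 0                   = refl
quadratic₁ 1                   = refl
quadratic₁ 2                   = refl
quadratic₁ (suc (suc (suc k))) = refl

-- The factor `X- (+ 2 / 1)` is the one by which the first elimination has multiplied.
quadratic₂ : X- 0ℚ P.* X P.+ P.- constant (+ 4 / 1) P.≈ X- (+ 2 / 1) P.* X- (- (+ 2 / 1))
quadratic₂ 0                   = refl
quadratic₂ 1                   = refl
quadratic₂ 2                   = refl
quadratic₂ (suc (suc (suc k))) = refl

-- Cancellation is available for factors of the form `X - a`, so the power of `X` left by the zero
-- matrix is read as one with `a = 0`.
X≈X-0 : X P.≈ X- 0ℚ
X≈X-0 0             = refl
X≈X-0 1             = refl
X≈X-0 (suc (suc k)) = refl

theorem3p7 : ∀ (m : ℕ) (W₁ W₂ : Matrix ℚ m m) → SemiOrthogonal W₁ W₂ →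
    (∃ λ (G : SignedGraph (m + (m + m))) → adjacencyMatrix G ≋ 𝒜 W₁ W₂)
    × (∀ (G : SignedGraph (m + (m + m))) → adjacencyMatrix G ≋ 𝒜 W₁ W₂ →
    HasSpectrum (adjacencyMatrix G)
    (replicate m (+ 4 / 1) ++ replicate (2 * m) (- (+ 2 / 1))))
theorem3p7 m W₁ W₂ semi = 𝒜-signedGraph W₁ W₂ semi , spectrum
  where
  open import Relation.Binary.Reasoning.Setoid P.setoid

  spectrum : ∀ G → adjacencyMatrix G ≋ 𝒜 W₁ W₂ →
             HasSpectrum (adjacencyMatrix G) (replicate m (+ 4 / 1) ++ replicate (2 * m) (- (+ 2 / 1)))
  spectrum G G≋𝒜 = begin
    det (charMatrix (adjacencyMatrix G))
      ≈⟨ det-cong {A = charMatrix (adjacencyMatrix G)} {charMatrix (𝒜′ W₁ W₂ semi)}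
           (charMatrix-cong λ i j → trans (G≋𝒜 i j) (sym (𝒜-blocks W₁ W₂ semi i j))) ⟩
    det (charMatrix (𝒜′ W₁ W₂ semi))
      ≈⟨ cancel-deflations m
           (X- (+ 2 / 1)) (X- 0ℚ) (X- (+ 4 / 1)) (X- (- (+ 2 / 1)))
           (X- (+ 2 / 1) P.* X P.+ P.- constant (+ 8 / 1)) (X- 0ℚ P.* X P.+ P.- constant (+ 4 / 1)) X
           (det (charMatrix (𝒜′ W₁ W₂ semi))) (det (charMatrix (corner W₁ W₂ semi))) (det (charMatrix (O m m)))
           (ℚ[X].[X-a]-cancelˡ (+ 2 / 1)) (ℚ[X].[X-a]-cancelˡ 0ℚ) quadratic₁ quadratic₂ X≈X-0
           (det-charMatrix-O m)
           (charMatrix-deflation (W₁ ∥ W₂) (W₁ ᵗ ⫽ W₂ ᵗ) (corner W₁ W₂ semi) (+ 2 / 1) (+ 8 / 1)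
             ([W₁∥W₂]·[W₁ᵗ⫽W₂ᵗ] W₁ W₂ semi) ([W₁∥W₂]·corner W₁ W₂ semi))
           (charMatrix-deflation (upper W₁ W₂ semi) (lower W₁ W₂ semi) (O m m) 0ℚ (+ 4 / 1)
             (upper·lower W₁ W₂ semi) (upper·O W₁ W₂ semi)) ⟩
    X- (+ 4 / 1) ^ m P.* X- (- (+ 2 / 1)) ^ (2 * m)
      ≈⟨ foldr-replicate-++ X- m (2 * m) (+ 4 / 1) (- (+ 2 / 1)) ⟨
    List.foldr (λ λᵢ p → X- λᵢ P.* p) P.1# (replicate m (+ 4 / 1) ++ replicate (2 * m) (- (+ 2 / 1))) ∎
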